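{- Let $n\ge1$. For every lattice path $\pi\in\mathcal L_{n,n}$ we have $\operatorname{sw}(\pi)=\zeta_C(\pi)$. In particular, the sweep map $\operatorname{sw}:\mathcal L_{n,n}\to\mathcal B_n$ is a bijection.
   Context: $\mathcal L_{n,n}$: lattice paths from $(0,0)$ to $(n,n)$ with steps $N=(0,1)$, $E=(1,0)$; $\mathcal B_n$: lattice paths from $(0,0)$ with $2n$ steps in $\{N,E\}$ never going below $x=y$. Sweep map: for $\pi=s_1s_2\cdots s_{2n}$, assign labels $\ell(s_1)=0$, $\ell(s_{i+1})=\ell(s_i)+2n+1$ if $s_i=N$ and $\ell(s_{i+1})=\ell(s_i)-2n$ if $s_i=E$. Form a collection $X$ of $2n$ labelled steps: for each $i$ with $\ell(s_i)<0$ include $(s_i,\ell(s_i))$; for each $i$ with $\ell(s_i)>0$ include $(s_{i-1},-\ell(s_i))$; and for $s_1$ (the only step labelled $0$) include $(s_{2n},-n)$. Then $\operatorname{sw}(\pi)$ is the path obtained by drawing the steps of $X$ in order of increasing label. Type $C$ area vector of $\pi$: $a_i=i-b_i$, $b_i$ the $x$-coordinate of the $i$-th North step. $\zeta_C(\pi)$: start at $(0,0)$ with $i=n$; read the area vector left to right drawing $E$ for each entry $-i-1$ and $N$ for each entry $-i$, then right to left drawing $E$ for each entry $i+1$ and $N$ for each entry $i$; decrease $i$ by $1$ and repeat, stopping once $2n$ steps are drawn. -}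

module Defs where

open import Data.Nat as ℕ using (ℕ; zero; suc; _+_)
open import Data.Integer as ℤ using (ℤ; +_; -[1+_]; -_; _-_)
open import Data.List using (List; []; _∷_; [_]; _++_; reverse; concat; map; take; upTo; length)
open import Data.Bool using (Bool; if_then_else_)
open import Relation.Nullary using (does)

-- Lattice steps: N = (0,1), E = (1,0).  A path is a list of steps.
data Step : Set where
  N E : Step

numN : List Step → ℕ
numN [] = 0
numN (N ∷ p) = suc (numN p)
numN (E ∷ p) = numN p

numE : List Step → ℕ
numE [] = 0
numE (N ∷ p) = numE p
numE (E ∷ p) = suc (numE p)

IsL : ℕ → List Step → Set
IsL n p = (numN p ≡ n) × (numE p ≡ n)
  where open import Relation.Binary.PropositionalEquality using (_≡_)
        open import Data.Product using (_×_)

IsB : ℕ → List Step → Set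
IsB n p = (length p ≡ n + n) × (∀ k → numE (take k p) ℕ.≤ numN (take k p))
  where open import Relation.Binary.PropositionalEquality using (_≡_)
        open import Data.Product using (_×_)

δ : ℕ → Step → ℤ
δ n N = + suc (n + n)
δ n E = - (+ (n + n))

labelsFrom : ℕ → ℤ → List Step → List ℤ
labelsFrom n ℓ [] = []
labelsFrom n ℓ (s ∷ p) = ℓ ∷ labelsFrom n (ℓ ℤ.+ δ n s) p

labels : ℕ → List Step → List ℤ
labels n p = labelsFrom n (+ 0) p

lastD : Step → List Step → Step
lastD d [] = d
lastD d (s ∷ p) = lastD s p

dropLast : List Step → List Step
dropLast [] = []
dropLast (s ∷ []) = []
dropLast (s ∷ t ∷ p) = s ∷ dropLast (t ∷ p)

prevs : List Step → List Step
prevs [] = []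
prevs (s ∷ p) = lastD s p ∷ dropLast (s ∷ p)

record LStep : Set where
  constructor _at_
  field
    step  : Step
    label : ℤ

entry : ℕ → Step → Step → ℤ → LStep
entry n s prev -[1+ k ]    = s at -[1+ k ]
entry n s prev (+ suc k)   = prev at (- (+ suc k))
entry n s prev (+ zero)    = prev at (- (+ n))           -- i = 1     : (s_{2n}, -n)

zipWith3 : {A B C D : Set} → (A → B → C → D) → List A → List B → List C → List D
zipWith3 f (a ∷ as) (b ∷ bs) (c ∷ cs) = f a b c ∷ zipWith3 f as bs cs
zipWith3 f _ _ _ = []

sweepX : ℕ → List Step → List LStep
sweepX n p = zipWith3 (entry n) p (prevs p) (labels n p)

insertL : LStep → List LStep → List LStep
insertL x [] = x ∷ []
insertL x (y ∷ ys) =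
  if does (LStep.label x ℤ.≤? LStep.label y) then x ∷ y ∷ ys else y ∷ insertL x ys

sortL : List LStep → List LStep
sortL [] = []
sortL (x ∷ xs) = insertL x (sortL xs)

sw : ℕ → List Step → List Step
sw n p = map LStep.step (sortL (sweepX n p))

-- a_i = i - b_i, b_i = x-coordinate of the i-th North step
-- (x = current x-coordinate, j = number of North steps read so far)
areaFrom : ℕ → ℕ → List Step → List ℤ
areaFrom x j [] = []
areaFrom x j (N ∷ p) = (+ suc j - + x) ∷ areaFrom x (suc j) p
areaFrom x j (E ∷ p) = areaFrom (suc x) j p

areaC : List Step → List ℤ
areaC p = areaFrom 0 0 p

_==_ : ℤ → ℤ → Bool
a == b = does (a ℤ.≟ b)

passL : ℤ → List ℤ → List Step
passL i [] = []
passL i (v ∷ a) =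
  (if v == (- i - + 1) then [ E ] else if v == (- i) then [ N ] else []) ++ passL i a

passR : ℤ → List ℤ → List Step
passR i a = go (reverse a)
  where
  go : List ℤ → List Step
  go [] = []
  go (v ∷ b) = (if v == (i ℤ.+ + 1) then [ E ] else if v == i then [ N ] else []) ++ go b

level : ℤ → List ℤ → List Step
level i a = passL i a ++ passR i a

-- ζ_C(π): levels i = n, n-1, …, -n in turn; keep the first 2n steps drawn.
-- (All steps are produced by level i = -1, so the levels down to -n suffice.)
ζC : ℕ → List Step → List Step
ζC n p = take (n + n) (concat (map (λ k → level (+ n - + k) (areaC p)) (upTo (suc (n + n)))))

{-# OPTIONS --safe #-}
module Submission where

-- Each lattice point of π after the first contributes one step to X: the step entering it if it lies
-- weakly left of the line x = y, the step leaving it otherwise.  As ℓ = 2n (y − x) + y at (x , y),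
-- sorting groups the points by the distance m of their diagonal from x = y, in decreasing order of m;
-- inside a group come first the points with y − x = m from top to bottom, then those with x − y = m
-- from bottom to top.  A path crosses the gap between two adjacent diagonals alternately upwards and
-- downwards, so each E step of a group can be traded for an N step crossing the same gap, which turns
-- the groups into the passes of ζ_C.
--
-- Every N step is drawn once as N and once, one group later, as E, except that those ending on x = y
-- are drawn twice as N.  Hence sw(π) never goes below x = y, and its final height is twice the number
-- of N steps of π ending on x = y.  Starting from this number the passes can be peeled off the end of
-- sw(π), since each of them but the last is empty or ends with N; and the passes determine the steps
-- leaving each diagonal, hence π.  Conversely, turning the E steps of π that reach a new lowest
-- diagonal into N steps maps 𝓛_{n,n} onto 𝓑_n, so the injection sw of 𝓛_{n,n} into 𝓑_n is onto as well.

open import Defs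
open import Data.Bool using (if_then_else_)
open import Data.Empty using (⊥; ⊥-elim)
open import Data.Fin using (Fin; zero; suc; toℕ; combine)
open import Data.Fin.Properties using (pigeonhole; combine-injective)
open import Data.Integer as ℤ using (ℤ; +_; -[1+_])
import Data.Integer.Properties as ℤₚ
import Data.Integer.Tactic.RingSolver as ℤ-Solver
open import Data.List using (List; []; _∷_; [_]; head; _++_; reverse; map; length; concat; concatMap; upTo; applyUpTo; take)
open import Data.List.Properties using (++-assoc; ++-identityʳ; ++-cancelˡ; ∷-injective; map-++; unfold-reverse;
  reverse-++; reverse-map; reverse-involutive; reverse-injective; concatMap-++; length-map; map-upTo; take-all)
open import Data.List.Relation.Binary.Permutation.Propositional using (↭-sym)
open import Data.List.Relation.Binary.Permutation.Propositional.Properties using (All-resp-↭; ↭-reverse)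
open import Data.List.Relation.Unary.All as All using (All; []; _∷_)
import Data.List.Relation.Unary.All.Properties as Allₚ
open import Data.Nat using (ℕ; zero; suc; _+_; _*_; _∸_; _^_; _≤_; _<_; _≥_; z≤n; s≤s; _≟_; _<?_)
open import Data.Nat.Properties
open import Data.Nat.Tactic.RingSolver using (solve-∀)
open import Data.Product using (_×_; ∃; _,_; proj₁; proj₂)
open import Data.Sum using (_⊎_; inj₁; inj₂)
open import Data.Unit using (⊤; tt)
open import Function using (_∘_; flip)
open import Relation.Binary using (tri<; tri≈; tri>)
open import Relation.Binary.PropositionalEquality hiding ([_])
open import Relation.Nullary using (¬_; Dec; does; yes; no; contradiction)

private
  variable
    A B : Set

-- Coordinates, optional letters and concatenation in descending order.

east north : Step → ℕ → ℕ
east N x = x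
east E x = suc x
north N y = suc y
north E y = y

guard : {P : Set} → Dec P → A → List A
guard (yes _) a = [ a ]
guard (no _)  a = []

guard-yes : {P : Set} (d : Dec P) {a : A} → P → guard d a ≡ [ a ]
guard-yes (yes _) _ = refl
guard-yes (no ¬p) p = contradiction p ¬p

guard-no : {P : Set} (d : Dec P) {a : A} → ¬ P → guard d a ≡ []
guard-no (yes p) ¬p = contradiction p ¬p
guard-no (no _)  _  = refl

descending : ℕ → (ℕ → List A) → List A
descending zero    f = f zero
descending (suc k) f = f (suc k) ++ descending k f

descending-cong : ∀ K {f g : ℕ → List A} → (∀ k → f k ≡ g k) → descending K f ≡ descending K g
descending-cong zero    f≗g = f≗g 0
descending-cong (suc K) f≗g = cong₂ _++_ (f≗g (suc K)) (descending-cong K f≗g)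

-- Insertion into separated blocks, and comparison of labels.

open LStep using (label; step)

-- The inequality has to be strict because `insertL` stops in front of an equal label.
insertL-++ʳ : ∀ z a b → All (λ u → label u ℤ.< label z) a → insertL z (a ++ b) ≡ a ++ insertL z b
insertL-++ʳ z []      b []         = refl
insertL-++ʳ z (u ∷ a) b (u<z ∷ as) with label z ℤ.≤? label u
... | yes z≤u = contradiction z≤u (ℤₚ.<⇒≱ u<z)
... | no  _   = cong (u ∷_) (insertL-++ʳ z a b as)

insertL-++ˡ : ∀ z a b → All (λ u → label z ℤ.≤ label u) b → insertL z (a ++ b) ≡ insertL z a ++ b
insertL-++ˡ z [] []      _ = refl
insertL-++ˡ z [] (u ∷ b) (z≤u ∷ _) with label z ℤ.≤? label u
... | yes _   = refl
... | no  z≰u = contradiction z≤u z≰u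
insertL-++ˡ z (u ∷ a) b bs with label z ℤ.≤? label u
... | yes _ = refl
... | no  _ = cong (u ∷_) (insertL-++ˡ z a b bs)

-- Meant for blocks with separated label ranges: insertion passes over the blocks of larger index,
-- which hold the smaller labels, and affects block `k₀` only.
insertL-descending : ∀ K {k₀} {f f′ : ℕ → List LStep} z → k₀ ≤ K →
  (∀ k → k ≢ k₀ → f′ k ≡ f k) →
  (∀ k → k₀ < k → All (λ u → label u ℤ.< label z) (f k)) →
  (∀ k → k < k₀ → All (λ u → label z ℤ.≤ label u) (f k)) →
  insertL z (f k₀) ≡ f′ k₀ → insertL z (descending K f) ≡ descending K f′
insertL-descending zero z z≤n other above below here = here
insertL-descending (suc K) {k₀} {f} {f′} z k₀≤K other above below here with m≤n⇒m<n∨m≡n k₀≤K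
... | inj₁ k₀<sK = trans (insertL-++ʳ z (f (suc K)) (descending K f) (above (suc K) k₀<sK))
      (cong₂ _++_ (sym (other (suc K) (λ e → <⇒≢ k₀<sK (sym e))))
                  (insertL-descending K z (≤-pred k₀<sK) other above below here))
... | inj₂ refl = trans (insertL-++ˡ z (f (suc K)) (descending K f) (below-descending K ≤-refl))
      (cong₂ _++_ here (unchanged K ≤-refl))
  where
  below-descending : ∀ J → J < suc K → All (λ u → label z ℤ.≤ label u) (descending J f)
  below-descending zero    J<   = below 0 J<
  below-descending (suc J) J<   = Allₚ.++⁺ (below (suc J) J<) (below-descending J (<-trans (n<1+n J) J<))
  unchanged : ∀ J → J < suc K → descending J f ≡ descending J f′
  unchanged zero    J< = sym (other 0 (<⇒≢ J<))
  unchanged (suc J) J< = cong₂ _++_ (sym (other (suc J) (<⇒≢ J<))) (unchanged J (<-trans (n<1+n J) J<))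

-- Labels are compared as differences of naturals, with both sides moved so that no subtraction occurs.
-ᶻ-≡⁻ : ∀ {a b c d} → + a ℤ.- + b ≡ + c ℤ.- + d → a + d ≡ c + b
-ᶻ-≡⁻ {a} {b} {c} {d} e = ℤₚ.+-injective (begin
  + a ℤ.+ + d                   ≡⟨ lhs (+ a) (+ b) (+ d) ⟩
  + a ℤ.- + b ℤ.+ (+ b ℤ.+ + d) ≡⟨ cong (ℤ._+ (+ b ℤ.+ + d)) e ⟩
  + c ℤ.- + d ℤ.+ (+ b ℤ.+ + d) ≡⟨ rhs (+ c) (+ b) (+ d) ⟩
  + c ℤ.+ + b ∎)
  where
  open ≡-Reasoning
  lhs : ∀ a b d → a ℤ.+ d ≡ a ℤ.- b ℤ.+ (b ℤ.+ d)
  lhs = ℤ-Solver.solve-∀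
  rhs : ∀ c b d → c ℤ.- d ℤ.+ (b ℤ.+ d) ≡ c ℤ.+ b
  rhs = ℤ-Solver.solve-∀

-ᶻ-≤ : ∀ {a b c d} → a + d ≤ c + b → + a ℤ.- + b ℤ.≤ + c ℤ.- + d
-ᶻ-≤ {a} {b} {c} {d} h = subst₂ ℤ._≤_ (eq (+ a) (+ d) (+ b))
    (trans (cong (ℤ._- (+ d ℤ.+ + b)) (ℤₚ.+-comm (+ c) (+ b))) (eq′ (+ c) (+ b) (+ d)))
    (ℤₚ.+-monoˡ-≤ (ℤ.- (+ d ℤ.+ + b)) (ℤ.+≤+ h))
  where
  eq : ∀ a d b → a ℤ.+ d ℤ.- (d ℤ.+ b) ≡ a ℤ.- b
  eq = ℤ-Solver.solve-∀
  eq′ : ∀ c b d → b ℤ.+ c ℤ.- (d ℤ.+ b) ≡ c ℤ.- d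
  eq′ = ℤ-Solver.solve-∀

-ᶻ-< : ∀ {a b c d} → a + d < c + b → + a ℤ.- + b ℤ.< + c ℤ.- + d
-ᶻ-< {a} {b} {c} {d} h = ℤₚ.≤∧≢⇒< (-ᶻ-≤ {a} {b} {c} {d} (<⇒≤ h)) (λ e → <⇒≢ h (-ᶻ-≡⁻ {a} {b} {c} {d} e))

-ᶻ-≡ : ∀ {a b c d} → a + d ≡ c + b → + a ℤ.- + b ≡ + c ℤ.- + d
-ᶻ-≡ {a} {b} {c} {d} e = ℤₚ.≤-antisym (-ᶻ-≤ {a} {b} {c} {d} (≤-reflexive e))
                                      (-ᶻ-≤ {c} {d} {a} {b} (≤-reflexive (sym e)))

-ᶻ-swap : ∀ a b → ℤ.- (+ a ℤ.- + b) ≡ + b ℤ.- + a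
-ᶻ-swap a b = eq (+ a) (+ b)
  where
  eq : ∀ i j → ℤ.- (i ℤ.- j) ≡ j ℤ.- i
  eq = ℤ-Solver.solve-∀

All-reverse : {P : A → Set} {a : List A} → All P a → All P (reverse a)
All-reverse {a = a} = All-resp-↭ (↭-sym (↭-reverse a))

insertL-between : ∀ z a b → All (λ u → label u ℤ.< label z) a → All (λ u → label z ℤ.≤ label u) b →
  insertL z (a ++ b) ≡ a ++ z ∷ b
insertL-between z a b a<z z≤b = trans (insertL-++ʳ z a b a<z) (cong (a ++_) (insertL-++ˡ z [] b z≤b))

reverse-∷-++ : ∀ (u : A) a b → reverse (u ∷ a) ++ b ≡ reverse a ++ u ∷ b
reverse-∷-++ u a b = trans (cong (_++ b) (unfold-reverse u a)) (++-assoc (reverse a) [ u ] b)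

-- Entries of X by diagonal, and their sorted order.

entry-pos : ∀ n s p {i} t → i ≡ + t → 1 ≤ t → entry n s p i ≡ p at (ℤ.- i)
entry-pos n s p (suc t) refl _ = refl

entry-neg : ∀ n s p {i} → i ℤ.< + 0 → entry n s p i ≡ s at i
entry-neg n s p { -[1+ k ]} _            = refl
entry-neg n s p {+ k}       (ℤ.+<+ ())

-- In what follows the suffix R at m refers to the diagonal y − x = m, and L at m to x − y = m + 1;
-- the diagonals at distance k from x = y are thus R at k and, if k > 0, L at k − 1.
tail-block : (ℕ → List A) → ℕ → List A
tail-block f zero    = []
tail-block f (suc m) = f m

module _ (n : ℕ) where

  -- The invariant of the inductions on suffixes `q` of the path, read from the point (x, y).
  Ends : ℕ → ℕ → List Step → Set
  Ends x y q = x + numE q ≡ n × y + numN q ≡ n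

  ends-step : ∀ s x y q → Ends x y (s ∷ q) → Ends (east s x) (north s y) q
  ends-step N x y q (ex , ey) = ex , trans (sym (+-suc y _)) ey
  ends-step E x y q (ex , ey) = trans (sym (+-suc x _)) ex , ey

  ends-x≤ : ∀ {x y} q → Ends x y q → x ≤ n
  ends-x≤ {x} q (ex , _) = m+n≤o⇒m≤o x (≤-reflexive ex)

  ends-y≤ : ∀ {x y} q → Ends x y q → y ≤ n
  ends-y≤ {y = y} q (_ , ey) = m+n≤o⇒m≤o y (≤-reflexive ey)

  ends-[] : ∀ {x y} → Ends x y [] → x ≡ n × y ≡ n
  ends-[] (ex , ey) = trans (sym (+-identityʳ _)) ex , trans (sym (+-identityʳ _)) ey

  -- Closed form of ℓ, kept as a single difference of naturals so that the comparison lemmas apply.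
  labelAt : ℕ → ℕ → ℤ
  labelAt x y = + ((n + n) * y + y) ℤ.- + ((n + n) * x)

  labelAt-step : ∀ s x y → labelAt x y ℤ.+ δ n s ≡ labelAt (east s x) (north s y)
  labelAt-step N x y = trans (eq (+ ((n + n) * y + y)) (+ ((n + n) * x)) (+ suc (n + n)))
                         (cong (λ t → + t ℤ.- + ((n + n) * x)) (eqℕ n y))
    where
    eq : ∀ a b c → a ℤ.- b ℤ.+ c ≡ a ℤ.+ c ℤ.- b
    eq = ℤ-Solver.solve-∀
    eqℕ : ∀ n y → (n + n) * y + y + suc (n + n) ≡ (n + n) * suc y + suc y
    eqℕ = solve-∀
  labelAt-step E x y = trans (eq (+ ((n + n) * y + y)) (+ ((n + n) * x)) (+ (n + n)))
                         (cong (λ t → + ((n + n) * y + y) ℤ.- + t) (eqℕ n x))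
    where
    eq : ∀ a b c → a ℤ.- b ℤ.+ ℤ.- c ≡ a ℤ.- (b ℤ.+ c)
    eq = ℤ-Solver.solve-∀
    eqℕ : ∀ n x → (n + n) * x + (n + n) ≡ (n + n) * suc x
    eqℕ = solve-∀

  -- The labels that X gives to points at height y: on R the label of the point is negated and falls
  -- with y, on L it is kept and rises with y.
  labelR labelL : ℕ → ℕ → ℤ
  labelR m y = + 0 ℤ.- + ((n + n) * m + y)
  labelL m y = + y ℤ.- + ((n + n) * suc m)

  labelAt-R : ∀ x m → ℤ.- labelAt x (x + m) ≡ labelR m (x + m)
  labelAt-R x m = trans (-ᶻ-swap ((n + n) * (x + m) + (x + m)) ((n + n) * x))
                    (-ᶻ-≡ {(n + n) * x} {_} {0} (eq n x m))
    where
    eq : ∀ n x m → (n + n) * x + ((n + n) * m + (x + m)) ≡ (n + n) * (x + m) + (x + m)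
    eq = solve-∀

  labelAt-L : ∀ y m → labelAt (suc (y + m)) y ≡ labelL m y
  labelAt-L y m = -ᶻ-≡ {(n + n) * y + y} {_} {y} (eq n y m)
    where
    eq : ∀ n y m → (n + n) * y + y + (n + n) * suc m ≡ y + (n + n) * suc (y + m)
    eq = solve-∀

  -- The recursion stops before the endpoint (n, n): its entry is the one that X attaches to s_1,
  -- added in `sw-blocks`.
  entriesR : ℕ → Step → ℕ → ℕ → List Step → List LStep
  entriesR m prev x y []      = []
  entriesR m prev x y (s ∷ q) = guard (y ≟ x + m) (prev at (ℤ.- labelAt x y)) ++ entriesR m s (east s x) (north s y) q

  entriesL : ℕ → ℕ → ℕ → List Step → List LStep
  entriesL m x y []      = []
  entriesL m x y (s ∷ q) = guard (x ≟ suc (y + m)) (s at labelAt x y) ++ entriesL m (east s x) (north s y) q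

  -- A path meets each diagonal from bottom to top, so the R part is reversed to make its labels
  -- increase.
  entryBlock : Step → ℕ → ℕ → List Step → ℕ → List LStep
  entryBlock prev x y q k = reverse (entriesR k prev x y q) ++ tail-block (λ m → entriesL m x y q) k

  OnDiagonalR OnDiagonalL : ℕ → ℕ → LStep → Set
  OnDiagonalR m b u = ∃ λ y → b ≤ y × y ≤ n × label u ≡ labelR m y
  OnDiagonalL m b u = ∃ λ y → b ≤ y × y < n × label u ≡ labelL m y

  north-mono : ∀ s y → y ≤ north s y
  north-mono N y = n≤1+n y
  north-mono E y = ≤-refl

  east-mono : ∀ s x → x ≤ east s x
  east-mono N x = ≤-refl
  east-mono E x = n≤1+n x

  -- b is at most y or at most the height x + m at which the column x meets the diagonal: either way no
  -- later point of the diagonal is below b.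
  entriesR-on : ∀ m b prev x y q → Ends x y q → b ≤ y ⊎ b ≤ x + m → All (OnDiagonalR m b) (entriesR m prev x y q)
  entriesR-on m b prev x y []      e h = []
  entriesR-on m b prev x y (s ∷ q) e h =
    Allₚ.++⁺ here (entriesR-on m b s _ _ q (ends-step s x y q e) (next h))
    where
    next : b ≤ y ⊎ b ≤ x + m → b ≤ north s y ⊎ b ≤ east s x + m
    next (inj₁ p) = inj₁ (≤-trans p (north-mono s y))
    next (inj₂ p) = inj₂ (≤-trans p (+-monoˡ-≤ m (east-mono s x)))
    b≤ : y ≡ x + m → b ≤ y ⊎ b ≤ x + m → b ≤ y
    b≤ _    (inj₁ p) = p
    b≤ refl (inj₂ p) = p
    here : All (OnDiagonalR m b) (guard (y ≟ x + m) (prev at (ℤ.- labelAt x y)))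
    here with y ≟ x + m
    ... | yes refl = (x + m , b≤ refl h , ends-y≤ (s ∷ q) e , labelAt-R x m) ∷ []
    ... | no _     = []

  -- The column x meets the diagonal at height x - m - 1, whence the form of the second alternative.
  entriesL-on : ∀ m b x y q → Ends x y q → b ≤ y ⊎ suc (b + m) ≤ x → All (OnDiagonalL m b) (entriesL m x y q)
  entriesL-on m b x y []      e h = []
  entriesL-on m b x y (s ∷ q) e h =
    Allₚ.++⁺ here (entriesL-on m b _ _ q (ends-step s x y q e) (next h))
    where
    next : b ≤ y ⊎ suc (b + m) ≤ x → b ≤ north s y ⊎ suc (b + m) ≤ east s x
    next (inj₁ p) = inj₁ (≤-trans p (north-mono s y))
    next (inj₂ p) = inj₂ (≤-trans p (east-mono s x))
    b≤ : x ≡ suc (y + m) → b ≤ y ⊎ suc (b + m) ≤ x → b ≤ y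
    b≤ _    (inj₁ p) = p
    b≤ refl (inj₂ p) = +-cancelʳ-≤ m b y (≤-pred p)
    here : All (OnDiagonalL m b) (guard (x ≟ suc (y + m)) (s at labelAt x y))
    here with x ≟ suc (y + m)
    ... | yes refl = (y , b≤ refl h , ≤-trans (s≤s (m≤m+n y m)) (ends-x≤ (s ∷ q) e) , labelAt-L y m) ∷ []
    ... | no _     = []

  -- Heights 0 to n on R give labels from -2nk - n to -2nk; heights 0 to n - 1 on L give -2nk to
  -- -2nk + n - 1. These half-open windows have width 2n and abut: `hi (suc k)` has the value of
  -- `lo k`.
  lo hi : ℕ → ℤ
  lo k = labelR k n
  hi k = + n ℤ.- + ((n + n) * k)

  module _ (n≥1 : 1 ≤ n) where

    InBlock : ℕ → LStep → Set
    InBlock k u = lo k ℤ.≤ label u × label u ℤ.< hi k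

    onDiagonalR⇒inBlock : ∀ k {b u} → OnDiagonalR k b u → InBlock k u
    onDiagonalR⇒inBlock k (y , _ , y≤n , refl) =
        -ᶻ-≤ {0} {_} {0} (+-monoʳ-≤ ((n + n) * k) y≤n)
      , -ᶻ-< {0} {_} {n} (≤-trans (s≤s (m≤m+n _ y)) (+-monoˡ-≤ ((n + n) * k + y) n≥1))

    onDiagonalL⇒inBlock : ∀ k {b u} → OnDiagonalL k b u → InBlock (suc k) u
    onDiagonalL⇒inBlock k (y , _ , y<n , refl) =
        -ᶻ-≤ {0} {_} {y} {(n + n) * suc k} (≤-trans (m≤m+n _ n) (m≤n+m _ y))
      , -ᶻ-< {y} {_} {n} (+-monoˡ-< ((n + n) * suc k) y<n)

    hi≤lo : ∀ {j k} → j < k → hi k ℤ.≤ lo j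
    hi≤lo {j} {k} j<k = -ᶻ-≤ {n} {_} {0} (≤-trans (≤-reflexive (eq n j)) (*-monoʳ-≤ (n + n) j<k))
      where
      eq : ∀ n j → n + ((n + n) * j + n) ≡ (n + n) * suc j
      eq = solve-∀

    entryBlock-inBlock : ∀ prev x y q → Ends x y q → ∀ k → All (InBlock k) (entryBlock prev x y q k)
    entryBlock-inBlock prev x y q e k =
      Allₚ.++⁺ (All-reverse (All.map (λ {u} → onDiagonalR⇒inBlock k {u = u}) (entriesR-on k 0 prev x y q e (inj₁ z≤n)))) (tl k)
      where
      tl : ∀ k → All (InBlock k) (tail-block (λ m → entriesL m x y q) k)
      tl zero    = []
      tl (suc m) = All.map (λ {u} → onDiagonalL⇒inBlock m {u = u}) (entriesL-on m 0 x y q e (inj₁ z≤n))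

    insert-block : ∀ prev x y q → Ends x y q → ∀ {k₀ z} {f′ : ℕ → List LStep} → k₀ ≤ n → InBlock k₀ z →
      (∀ k → k ≢ k₀ → f′ k ≡ entryBlock prev x y q k) → insertL z (entryBlock prev x y q k₀) ≡ f′ k₀ →
      insertL z (descending n (entryBlock prev x y q)) ≡ descending n f′
    insert-block prev x y q e {z = z} k₀≤n (lo≤ , <hi) other =
      insertL-descending n z k₀≤n other
        (λ k k₀<k → All.map (λ (_ , h) → ℤₚ.<-≤-trans h (ℤₚ.≤-trans (hi≤lo k₀<k) lo≤))
          (entryBlock-inBlock prev x y q e k))
        (λ k k<k₀ → All.map (λ (h , _) → ℤₚ.≤-trans (ℤₚ.<⇒≤ <hi) (ℤₚ.≤-trans (hi≤lo k<k₀) h))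
          (entryBlock-inBlock prev x y q e k))

    -- `dropLast (prev ∷ q)` lists the predecessors of the steps of `q`; the first step of the path
    -- is treated apart.
    sweepTail : Step → ℕ → ℕ → List Step → List LStep
    sweepTail prev x y q = zipWith3 (entry n) q (dropLast (prev ∷ q)) (labelsFrom n (labelAt x y) q)

    sweepTail-∷ : ∀ prev x y s q →
      sweepTail prev x y (s ∷ q) ≡ entry n s prev (labelAt x y) ∷ sweepTail s (east s x) (north s y) q
    sweepTail-∷ prev x y s q rewrite labelAt-step s x y = refl

    -- Induction from the end of the path. The current point is the lowest of its diagonal among
    -- those left, so its entry lands where the two halves of its block meet. The bound on x + y
    -- excludes the origin, whose label is zero.
    sort-sweepTail : ∀ prev x y q → Ends x y q → 1 ≤ x + y →
      sortL (sweepTail prev x y q) ≡ descending n (entryBlock prev x y q)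
    sort-sweepTail prev x y [] e h = empty n
      where
      empty : ∀ K → [] ≡ descending K (entryBlock prev x y [])
      empty zero          = refl
      empty (suc K)       = empty K
    sort-sweepTail prev x y (s ∷ q) e h = trans (cong sortL (sweepTail-∷ prev x y s q))
      (trans (cong (insertL (entry n s prev (labelAt x y)))
                   (sort-sweepTail s x′ y′ q e′ (≤-trans h (+-mono-≤ (east-mono s x) (north-mono s y)))))
             (by-side (≤-<-connex x y)))
      where
      x′ = east s x
      y′ = north s y
      e′ = ends-step s x y q e
      Goal : Set
      Goal = insertL (entry n s prev (labelAt x y)) (descending n (entryBlock s x′ y′ q))
        ≡ descending n (entryBlock prev x y (s ∷ q))
      by-side : x ≤ y ⊎ y < x → Goal
      by-side (inj₁ x≤y) with m≤n⇒∃[o]m+o≡n x≤y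
      ... | k , refl = trans
        (cong (λ z → insertL z (descending n (entryBlock s x′ y′ q)))
          (entry-pos n s prev (x + k + (n + n) * k) labelAt-pos positive))
        (insert-block s x′ y′ q e′ (≤-trans (m≤n+m k x) (ends-y≤ (s ∷ q) e)) inside other here)
        where
        z = prev at (ℤ.- labelAt x (x + k))
        positive : 1 ≤ x + k + (n + n) * k
        positive = ≤-trans (pos x k h) (m≤m+n (x + k) _)
          where
          pos : ∀ x k → 1 ≤ x + (x + k) → 1 ≤ x + k
          pos zero    k h = h
          pos (suc x) k h = s≤s z≤n
        labelAt-pos : labelAt x (x + k) ≡ + (x + k + (n + n) * k)
        labelAt-pos = trans (-ᶻ-≡ {_} {(n + n) * x} {x + k + (n + n) * k} {0} (eq n x k)) (ℤₚ.+-identityʳ _)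
          where
          eq : ∀ n x k → (n + n) * (x + k) + (x + k) + 0 ≡ x + k + (n + n) * k + (n + n) * x
          eq = solve-∀
        left-unchanged : ∀ j →
          tail-block (λ m → entriesL m x (x + k) (s ∷ q)) j ≡ tail-block (λ m → entriesL m x′ y′ q) j
        left-unchanged zero    = refl
        left-unchanged (suc m) = cong (_++ entriesL m x′ y′ q)
          (guard-no (x ≟ suc (x + k + m)) (<⇒≢ (s≤s (≤-trans (m≤m+n x k) (m≤m+n _ m)))))
        inside : InBlock k z
        inside = onDiagonalR⇒inBlock k {u = z} (x + k , z≤n , ends-y≤ (s ∷ q) e , labelAt-R x k)
        other : ∀ j → j ≢ k → entryBlock prev x (x + k) (s ∷ q) j ≡ entryBlock s x′ y′ q j
        other j j≢k = cong₂ _++_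
          (cong (λ g → reverse (g ++ entriesR j s x′ y′ q))
            (guard-no (x + k ≟ x + j) (λ eq → j≢k (sym (+-cancelˡ-≡ x k j eq)))))
          (left-unchanged j)
        here : insertL z (entryBlock s x′ y′ q k) ≡ entryBlock prev x (x + k) (s ∷ q) k
        here = trans (insertL-between z (reverse (entriesR k s x′ y′ q)) _ before (after k refl))
          (sym (trans (cong₂ (λ g t → reverse (g ++ entriesR k s x′ y′ q) ++ t)
                 (guard-yes (x + k ≟ x + k) refl)
                 (left-unchanged k))
               (reverse-∷-++ z (entriesR k s x′ y′ q) _)))
          where
          -- Either step away from the diagonal raises the height or the column, so later points of
          -- this diagonal lie strictly higher.
          further : ∀ s → suc (x + k) ≤ north s (x + k) ⊎ suc (x + k) ≤ east s x + k
          further N = inj₁ ≤-refl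
          further E = inj₂ ≤-refl
          before : All (λ u → label u ℤ.< label z) (reverse (entriesR k s x′ y′ q))
          before = All-reverse (All.map
            (λ { (y₁ , y<y₁ , _ , refl) → subst (_ ℤ.<_) (sym (labelAt-R x k))
                   (-ᶻ-< {0} {_} {0} (+-monoʳ-< ((n + n) * k) y<y₁)) })
            (entriesR-on k (suc (x + k)) s x′ y′ q e′ (further s)))
          after : ∀ j → j ≡ k → All (λ u → label z ℤ.≤ label u) (tail-block (λ m → entriesL m x′ y′ q) j)
          after zero    _   = []
          after (suc m) m≡k = All.map
            (λ { (y₁ , _ , _ , refl) → subst (ℤ._≤ _) (sym (labelAt-R x k))
                   (-ᶻ-≤ {0} {(n + n) * k + (x + k)} {y₁} {(n + n) * suc m}
                   (≤-trans (≤-reflexive (cong ((n + n) *_) m≡k)) (≤-trans (m≤m+n _ (x + k)) (m≤n+m _ y₁)))) })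
            (entriesL-on m 0 x′ y′ q e′ (inj₁ z≤n))
      by-side (inj₂ y<x) with m≤n⇒∃[o]m+o≡n y<x
      ... | k , refl = trans
        (cong (λ z → insertL z (descending n (entryBlock s x′ y′ q))) (entry-neg n s prev labelAt-neg))
        (insert-block s x′ y′ q e′ (≤-trans (s≤s (m≤n+m k y)) (ends-x≤ (s ∷ q) e)) inside other here)
        where
        z = s at labelAt (suc (y + k)) y
        y<n : y < n
        y<n = ≤-trans (s≤s (m≤m+n y k)) (ends-x≤ (s ∷ q) e)
        above : ∀ j → guard (y ≟ suc (y + k) + j) (prev at (ℤ.- labelAt (suc (y + k)) y)) ≡ []
        above j = guard-no (y ≟ suc (y + k) + j) (<⇒≢ (s≤s (≤-trans (m≤m+n y k) (m≤m+n _ j))))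
        labelAt-neg : labelAt (suc (y + k)) y ℤ.< + 0
        labelAt-neg = subst (ℤ._< + 0) (sym (labelAt-L y k)) (-ᶻ-< {y} {_} {0} {0}
          (≤-trans (s≤s (≤-reflexive (+-identityʳ y))) (≤-trans y<n (≤-trans (m≤m+n n n) (m≤m*n (n + n) (suc k))))))
        inside : InBlock (suc k) z
        inside = onDiagonalL⇒inBlock k {u = z} (y , z≤n , y<n , labelAt-L y k)
        other : ∀ j → j ≢ suc k → entryBlock prev (suc (y + k)) y (s ∷ q) j ≡ entryBlock s x′ y′ q j
        other j j≢k = cong₂ _++_
          (cong (λ g → reverse (g ++ entriesR j s x′ y′ q)) (above j))
          (tl j j≢k)
          where
          tl : ∀ j → j ≢ suc k → tail-block (λ m → entriesL m x y (s ∷ q)) j ≡ tail-block (λ m → entriesL m x′ y′ q) j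
          tl zero    _   = refl
          tl (suc m) m≢k = cong (_++ entriesL m x′ y′ q) (guard-no (suc (y + k) ≟ suc (y + m))
            (λ eq → m≢k (cong suc (sym (+-cancelˡ-≡ y k m (suc-injective eq))))))
        here : insertL z (entryBlock s x′ y′ q (suc k)) ≡ entryBlock prev (suc (y + k)) y (s ∷ q) (suc k)
        here = trans (insertL-between z (reverse (entriesR (suc k) s x′ y′ q)) _ before after)
          (sym (cong₂ (λ g t → reverse (g ++ entriesR (suc k) s x′ y′ q) ++ t ++ entriesL k x′ y′ q)
                 (above (suc k)) (guard-yes (suc (y + k) ≟ suc (y + k)) refl)))
          where
          -- Points with y - x = k + 1 have height at least 1, which makes their labels strictly
          -- smaller even when y = 0.
          before : All (λ u → label u ℤ.< label z) (reverse (entriesR (suc k) s x′ y′ q))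
          before = All-reverse (All.map
            (λ { (y₁ , 1≤y₁ , _ , refl) → subst (_ ℤ.<_) (sym (labelAt-L y k))
                   (-ᶻ-< {0} {_} {y} (≤-trans (≤-trans (≤-reflexive (+-comm 1 _))
                     (+-monoʳ-≤ ((n + n) * suc k) 1≤y₁)) (m≤n+m _ y))) })
            (entriesR-on (suc k) 1 s x′ y′ q e′ (inj₂ (≤-trans (s≤s z≤n) (m≤n+m (suc k) x′)))))
          after : All (λ u → label z ℤ.≤ label u) (entriesL k x′ y′ q)
          after = All.map
            (λ { (y₁ , y≤y₁ , _ , refl) → subst (ℤ._≤ _) (sym (labelAt-L y k))
                   (-ᶻ-≤ {y} {_} {y₁} (+-monoˡ-≤ ((n + n) * suc k) y≤y₁)) })
            (entriesL-on k y x′ y′ q e′ (inj₁ (north-mono s y)))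

-- From the sorted entries to words in the N steps.

map-descending : (g : A → B) → ∀ K f → map g (descending K f) ≡ descending K (map g ∘ f)
map-descending g zero    f = refl
map-descending g (suc K) f = trans (map-++ g (f (suc K)) (descending K f)) (cong (map g (f (suc K)) ++_) (map-descending g K f))

map-guard : (g : A → B) {P : Set} (d : Dec P) {a : A} → map g (guard d a) ≡ guard d (g a)
map-guard g (yes _) = refl
map-guard g (no _)  = refl

guard-cong : {P Q : Set} (d : Dec P) (d′ : Dec Q) {a : A} → (P → Q) → (Q → P) → guard d a ≡ guard d′ a
guard-cong (yes p) d′ f g = sym (guard-yes d′ (f p))
guard-cong (no ¬p) d′ f g = sym (guard-no d′ (¬p ∘ g))

-- wordR and wordL look at N steps only.  In wordR an N step leaving the diagonal is read as the E step
-- that later returns to it; in wordL an N step entering it is read as the E step that left it before.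
incoming outgoingL wordR wordL outgoingR : ℕ → ℕ → ℕ → List Step → List Step
incoming m x y []      = []
incoming m x y (s ∷ q) = guard (north s y ≟ east s x + m) s ++ incoming m (east s x) (north s y) q

outgoingL m x y []      = []
outgoingL m x y (s ∷ q) = guard (x ≟ suc (y + m)) s ++ outgoingL m (east s x) (north s y) q

wordR m x y []      = []
wordR m x y (N ∷ q) = guard (suc y ≟ x + suc m) E ++ guard (suc y ≟ x + m) N ++ wordR m x (suc y) q
wordR m x y (E ∷ q) = wordR m (suc x) y q

wordL m x y []      = []
wordL m x y (N ∷ q) = guard (x ≟ suc y + suc m) E ++ guard (x ≟ suc y + m) N ++ wordL m x (suc y) q
wordL m x y (E ∷ q) = wordL m (suc x) y q

outgoingR m x y []      = []
outgoingR m x y (s ∷ q) = guard (y ≟ x + m) s ++ outgoingR m (east s x) (north s y) q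

-- A block joins the right-to-left pass of ζ_C at i = k to the left-to-right pass at i = k - 1; each
-- level is thus cut in its middle.
block : List Step → ℕ → List Step
block π k = reverse (wordR k 0 0 π) ++ tail-block (λ m → wordL m 0 0 π) k

tail-block-cong : ∀ {f g : ℕ → List A} → (∀ m → f m ≡ g m) → ∀ k → tail-block f k ≡ tail-block g k
tail-block-cong f≗g zero    = refl
tail-block-cong f≗g (suc m) = f≗g m

map-tail-block : (g : A → B) (f : ℕ → List A) → ∀ k → map g (tail-block f k) ≡ tail-block (map g ∘ f) k
map-tail-block g f zero    = refl
map-tail-block g f (suc m) = refl

module _ (n : ℕ) where

  -- `entriesR` lists a step at the point it enters, `incoming` when the step is read. The two
  -- guards account for `prev` in front and for the last step, which enters (n, n), at the back.
  entriesR-steps : ∀ m prev x y q → Ends n x y q →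
    map step (entriesR n m prev x y q) ++ guard (n ≟ n + m) (lastD prev q) ≡ guard (y ≟ x + m) prev ++ incoming m x y q
  entriesR-steps m prev x y [] e with refl , refl ← ends-[] n e = sym (++-identityʳ _)
  entriesR-steps m prev x y (s ∷ q) e = begin
    map step (guard (y ≟ x + m) _ ++ entriesR n m s x′ y′ q) ++ end
      ≡⟨ cong (_++ end) (map-++ step (guard (y ≟ x + m) _) (entriesR n m s x′ y′ q)) ⟩
    (map step (guard (y ≟ x + m) _) ++ map step (entriesR n m s x′ y′ q)) ++ end
      ≡⟨ ++-assoc (map step (guard (y ≟ x + m) _)) _ end ⟩
    map step (guard (y ≟ x + m) _) ++ map step (entriesR n m s x′ y′ q) ++ end
      ≡⟨ cong₂ _++_ (map-guard step (y ≟ x + m)) (entriesR-steps m s x′ y′ q (ends-step n s x y q e)) ⟩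
    guard (y ≟ x + m) prev ++ incoming m x y (s ∷ q) ∎
    where
    open ≡-Reasoning
    x′ = east s x
    y′ = north s y
    end = guard (n ≟ n + m) (lastD s q)

  entriesL-steps : ∀ m x y q → map step (entriesL n m x y q) ≡ outgoingL m x y q
  entriesL-steps m x y []      = refl
  entriesL-steps m x y (s ∷ q) = trans (map-++ step (guard (x ≟ suc (y + m)) _) _)
    (cong₂ _++_ (map-guard step (x ≟ suc (y + m))) (entriesL-steps m (east s x) (north s y) q))

  -- Above the diagonal, the path has an E step into it still to come.
  wordR-incoming : ∀ m x y q → Ends n x y q → guard (x + m <? y) E ++ wordR m x y q ≡ incoming m x y q
  wordR-incoming m x y [] e with refl , refl ← ends-[] n e =
    trans (++-identityʳ _) (guard-no (n + m <? n) (≤⇒≯ (m≤m+n n m)))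
  wordR-incoming m x y (N ∷ q) e = trans turn
      (cong (guard (suc y ≟ x + m) N ++_) (wordR-incoming m x (suc y) q (ends-step n N x y q e)))
    where
    r = wordR m x (suc y) q
    turn :
      guard (x + m <? y) E ++ guard (suc y ≟ x + suc m) E ++ guard (suc y ≟ x + m) N ++ r
      ≡ guard (suc y ≟ x + m) N ++ guard (x + m <? suc y) E ++ r
    E-eq : suc y ≡ x + suc m → y ≡ x + m
    E-eq eq = suc-injective (trans eq (+-suc x m))
    turn with <-cmp (suc y) (x + m)
    ... | tri< a ≢ _ rewrite guard-no (x + m <? y) {E} (<-asym (<-trans (n<1+n y) a))
           | guard-no (suc y ≟ x + suc m) {E} (<⇒≢ (<-trans (n<1+n y) a) ∘ E-eq)
           | guard-no (suc y ≟ x + m) {N} ≢ | guard-no (x + m <? suc y) {E} (<-asym a) = refl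
    ... | tri≈ ≮ eq ≯ rewrite guard-no (x + m <? y) {E} (λ h → ≯ (<-trans h (n<1+n y)))
           | guard-no (suc y ≟ x + suc m) {E} (λ eq′ → 1+n≢n (trans eq (sym (E-eq eq′))))
           | guard-yes (suc y ≟ x + m) {N} eq | guard-no (x + m <? suc y) {E} ≯ = refl
    ... | tri> _ ≢ c rewrite guard-no (suc y ≟ x + m) {N} ≢ | guard-yes (x + m <? suc y) {E} c with m≤n⇒m<n∨m≡n (≤-pred c)
    ...   | inj₁ h rewrite guard-yes (x + m <? y) {E} h | guard-no (suc y ≟ x + suc m) {E} (λ eq → <⇒≢ h (sym (E-eq eq))) = refl
    ...   | inj₂ refl rewrite guard-no (x + m <? x + m) {E} (<-irrefl refl)
           | guard-yes (suc (x + m) ≟ x + suc m) {E} (sym (+-suc x m)) = refl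
  wordR-incoming m x y (E ∷ q) e = trans (cong (_++ wordR m (suc x) y q) split)
      (trans (++-assoc (guard (y ≟ suc x + m) E) _ _)
        (cong (guard (y ≟ suc x + m) E ++_) (wordR-incoming m (suc x) y q (ends-step n E x y q e))))
    where
    split : guard (x + m <? y) E ≡ guard (y ≟ suc x + m) E ++ guard (suc x + m <? y) E
    split with <-cmp y (suc x + m)
    ... | tri< a ≢ _ rewrite guard-no (x + m <? y) {E} (λ h → ≤⇒≯ h a) | guard-no (y ≟ suc x + m) {E} ≢
           | guard-no (suc x + m <? y) {E} (<-asym a) = refl
    ... | tri≈ ≮ eq ≯ rewrite guard-yes (x + m <? y) {E} (≤-reflexive (sym eq)) | guard-yes (y ≟ suc x + m) {E} eq
           | guard-no (suc x + m <? y) {E} ≯ = refl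
    ... | tri> _ ≢ c rewrite guard-yes (x + m <? y) {E} (<⇒≤ c) | guard-no (y ≟ suc x + m) {E} ≢
           | guard-yes (suc x + m <? y) {E} c = refl

  -- Below the diagonal, the E step matching the next N step into it has already been taken.
  wordL-outgoingL : ∀ m x y q → Ends n x y q → wordL m x y q ≡ guard (suc (y + m) <? x) E ++ outgoingL m x y q
  wordL-outgoingL m x y [] e with refl , refl ← ends-[] n e =
    sym (trans (++-identityʳ _) (guard-no (suc (n + m) <? n) (λ h → ≤⇒≯ (m≤m+n n m) (<-trans (n<1+n _) h))))
  wordL-outgoingL m x y (N ∷ q) e = trans
      (cong (λ r → guard (x ≟ suc y + suc m) E ++ guard (x ≟ suc y + m) N ++ r)
        (wordL-outgoingL m x (suc y) q (ends-step n N x y q e)))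
      turn
    where
    r = outgoingL m x (suc y) q
    turn : guard (x ≟ suc y + suc m) E ++ guard (x ≟ suc y + m) N ++ guard (suc (suc y + m) <? x) E ++ r
      ≡ guard (suc (y + m) <? x) E ++ guard (x ≟ suc (y + m)) N ++ r
    turn rewrite +-suc y m with <-cmp x (suc (y + m))
    ... | tri< a ≢ ≯ rewrite guard-no (x ≟ suc y + m) {N} ≢ | guard-no (suc (y + m) <? x) {E} ≯
           | guard-no (x ≟ suc (suc (y + m))) {E} (λ eq → <⇒≢ (<-trans a (n<1+n _)) eq)
           | guard-no (suc (suc y + m) <? x) {E} (λ h → <-asym h (<-trans a (n<1+n _))) = refl
    ... | tri≈ ≮ eq ≯ rewrite guard-yes (x ≟ suc y + m) {N} eq | guard-no (suc (y + m) <? x) {E} ≯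
           | guard-no (x ≟ suc (suc (y + m))) {E} (λ eq′ → 1+n≢n (trans (sym eq′) eq))
           | guard-no (suc (suc y + m) <? x) {E} (λ h → ≯ (<-trans (n<1+n _) h)) = refl
    ... | tri> _ ≢ c rewrite guard-no (x ≟ suc y + m) {N} ≢ | guard-yes (suc (y + m) <? x) {E} c with m≤n⇒m<n∨m≡n c
    ...   | inj₁ h rewrite guard-yes (suc (suc y + m) <? x) {E} h | guard-no (x ≟ suc (suc (y + m))) {E} (λ eq → <⇒≢ h (sym eq)) = refl
    ...   | inj₂ refl rewrite guard-no (suc (suc y + m) <? suc (suc (y + m))) {E} (<-irrefl refl)
           | guard-yes (suc (suc (y + m)) ≟ suc (suc (y + m))) {E} refl = refl
  wordL-outgoingL m x y (E ∷ q) e = trans (wordL-outgoingL m (suc x) y q (ends-step n E x y q e))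
      (trans (cong (_++ outgoingL m (suc x) y q) split)
      (++-assoc (guard (suc (y + m) <? x) E) _ _))
    where
    split : guard (suc (y + m) <? suc x) E ≡ guard (suc (y + m) <? x) E ++ guard (x ≟ suc (y + m)) E
    split with <-cmp x (suc (y + m))
    ... | tri< a ≢ ≯ rewrite guard-no (x ≟ suc (y + m)) {E} ≢ | guard-no (suc (y + m) <? x) {E} ≯
           | guard-no (suc (y + m) <? suc x) {E} (λ h → ≤⇒≯ (≤-pred h) a) = refl
    ... | tri≈ ≮ eq ≯ rewrite guard-yes (x ≟ suc (y + m)) {E} eq | guard-no (suc (y + m) <? x) {E} ≯
           | guard-yes (suc (y + m) <? suc x) {E} (s≤s (≤-reflexive (sym eq))) = refl
    ... | tri> _ ≢ c rewrite guard-no (x ≟ suc (y + m)) {E} ≢ | guard-yes (suc (y + m) <? x) {E} c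
           | guard-yes (suc (y + m) <? suc x) {E} (<-trans c (n<1+n x)) = refl

  sweepX-∷ : ∀ s q → sweepX n (s ∷ q) ≡ (lastD s q at (ℤ.- (+ n))) ∷
    zipWith3 (entry n) q (dropLast (s ∷ q)) (labelsFrom n (labelAt n (east s 0) (north s 0)) q)
  sweepX-∷ s q = cong (λ ℓ → (lastD s q at (ℤ.- (+ n))) ∷ zipWith3 (entry n) q (dropLast (s ∷ q)) (labelsFrom n ℓ q))
    (trans (cong (ℤ._+ δ n s) (sym labelAt-00)) (labelAt-step n s 0 0))
    where
    labelAt-00 : labelAt n 0 0 ≡ + 0
    labelAt-00 = trans (cong₂ (λ a b → + a ℤ.- + b) (trans (+-identityʳ _) (*-zeroʳ (n + n))) (*-zeroʳ (n + n))) refl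

  -- The special label -n is what the rule for points weakly left of x = y gives at (n, n). The
  -- entry of s_1 thus acts as that of the endpoint, and it has the least label of block 0.
  sw-blocks : 1 ≤ n → ∀ π → IsL n π → sw n π ≡ descending n (block π)
  sw-blocks n≥1 [] (refl , _) = contradiction n≥1 (λ ())
  sw-blocks n≥1 (s ∷ q) (eN , eE) = begin
    map step (sortL (sweepX n (s ∷ q)))
      ≡⟨ cong (map step ∘ sortL) (sweepX-∷ s q) ⟩
    map step (insertL z (sortL (sweepTail n n≥1 s x y q)))
      ≡⟨ cong (map step ∘ insertL z) (sort-sweepTail n n≥1 s x y q ends (positive s)) ⟩
    map step (insertL z (descending n (entryBlock n s x y q)))
      ≡⟨ cong (map step) (insert-block n n≥1 s x y q ends {0} {z} {f′} z≤n inside other here) ⟩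
    map step (descending n f′)
      ≡⟨ map-descending step n f′ ⟩
    descending n (map step ∘ f′)
      ≡⟨ descending-cong n words ⟩
    descending n (block (s ∷ q)) ∎
    where
    open ≡-Reasoning
    x = east s 0
    y = north s 0
    z = lastD s q at (ℤ.- (+ n))
    ends : Ends n x y q
    ends = ends-step n s 0 0 q (eE , eN)
    positive : ∀ s → 1 ≤ east s 0 + north s 0
    positive N = ≤-refl
    positive E = ≤-refl
    R L : ℕ → List LStep
    R k = entriesR n k s x y q
    L m = entriesL n m x y q
    -- The endpoint closes the list of its diagonal, so reversal puts it first.
    f′ : ℕ → List LStep
    f′ k = reverse (R k ++ guard (n ≟ n + k) z) ++ tail-block L k
    label-z : ℤ.- (+ n) ≡ labelR n 0 n
    label-z = trans (cong (λ t → ℤ.- (+ (t + n))) (sym (*-zeroʳ (n + n)))) (sym (ℤₚ.+-identityˡ _))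
    inside : InBlock n n≥1 0 z
    inside = onDiagonalR⇒inBlock n n≥1 0 {0} {z} (n , z≤n , ≤-refl , label-z)
    other : ∀ k → k ≢ 0 → f′ k ≡ entryBlock n s x y q k
    other k k≢0 = cong (λ r → reverse r ++ tail-block L k)
      (trans (cong (R k ++_) (guard-no (n ≟ n + k) (λ eq → k≢0 (+-cancelˡ-≡ n k 0 (trans (sym eq) (sym (+-identityʳ n)))))))
             (++-identityʳ (R k)))
    here : insertL z (entryBlock n s x y q 0) ≡ f′ 0
    here = trans (insertL-++ˡ z [] (entryBlock n s x y q 0)
                   (All.map (λ {u} (h , _) → subst (ℤ._≤ label u) (sym label-z) h) (entryBlock-inBlock n n≥1 s x y q ends 0)))
      (cong (_++ []) (sym (trans (cong (λ g → reverse (R 0 ++ g)) (guard-yes (n ≟ n + 0) (sym (+-identityʳ n))))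
        (reverse-++ (R 0) [ z ]))))
    right : ∀ k → map step (R k ++ guard (n ≟ n + k) z) ≡ wordR k 0 0 (s ∷ q)
    right k = trans (map-++ step (R k) _) (trans (cong (map step (R k) ++_) (map-guard step (n ≟ n + k)))
      (trans (entriesR-steps k s x y q ends) (trans (sym (wordR-incoming k 0 0 (s ∷ q) (eE , eN)))
        (cong (_++ wordR k 0 0 (s ∷ q)) (guard-no (k <? 0) {E} (λ ()))))))
    left : ∀ m → map step (L m) ≡ wordL m 0 0 (s ∷ q)
    left m = trans (entriesL-steps m x y q) (sym (trans (wordL-outgoingL m 0 0 (s ∷ q) (eE , eN))
      (cong₂ (λ a b → a ++ b ++ outgoingL m x y q) (guard-no (suc m <? 0) {E} (λ ())) (guard-no (0 ≟ suc m) {s} (λ ())))))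
    words : ∀ k → map step (f′ k) ≡ block (s ∷ q) k
    words k = trans (map-++ step (reverse (R k ++ guard (n ≟ n + k) z)) _)
      (cong₂ _++_ (trans (reverse-map step (R k ++ guard (n ≟ n + k) z)) (cong reverse (right k)))
                  (trans (map-tail-block step L k) (tail-block-cong left k)))

-- The passes of ζ_C are the same words.

-- As the two tests exclude each other, the nested conditional splits into independent guards, whose
-- tests can be restated over the naturals.
if-guard : {P P′ Q Q′ : Set} (d : Dec P) (d′ : Dec Q) (e : Dec P′) (e′ : Dec Q′) {a b : A} →
  (P → P′) → (P′ → P) → (Q → Q′) → (Q′ → Q) → (P → ¬ Q) →
  (if does d then [ a ] else if does d′ then [ b ] else []) ≡ guard e a ++ guard e′ b
if-guard (yes p) d′      e e′ {a} {b} f f⁻ g g⁻ ⊥ rewrite guard-yes e {a} (f p) | guard-no e′ {b} (⊥ p ∘ g⁻) = refl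
if-guard (no ¬p) (yes q) e e′ {a} {b} f f⁻ g g⁻ ⊥ rewrite guard-no e {a} (¬p ∘ f⁻) | guard-yes e′ {b} (g q) = refl
if-guard (no ¬p) (no ¬q) e e′ {a} {b} f f⁻ g g⁻ ⊥ rewrite guard-no e {a} (¬p ∘ f⁻) | guard-no e′ {b} (¬q ∘ g⁻) = refl

passL-wordL : ∀ m x j p → passL (+ m) (areaFrom x j p) ≡ wordL m x j p
passL-wordL m x j []      = refl
passL-wordL m x j (E ∷ p) = passL-wordL m (suc x) j p
passL-wordL m x j (N ∷ p) = trans (cong₂ _++_ first (passL-wordL m x (suc j) p))
    (++-assoc (guard (x ≟ suc j + suc m) E) _ _)
  where
  v = + suc j ℤ.- + x
  eq₁ : ∀ i → ℤ.- i ℤ.- + 1 ≡ + 0 ℤ.- (+ 1 ℤ.+ i)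
  eq₁ = ℤ-Solver.solve-∀
  to₁ : v ≡ ℤ.- (+ m) ℤ.- + 1 → x ≡ suc j + suc m
  to₁ e = sym (-ᶻ-≡⁻ {suc j} {x} {0} {suc m} (trans e (eq₁ (+ m))))
  from₁ : x ≡ suc j + suc m → v ≡ ℤ.- (+ m) ℤ.- + 1
  from₁ e = trans (-ᶻ-≡ {suc j} {x} {0} {suc m} (sym e)) (sym (eq₁ (+ m)))
  to₂ : v ≡ ℤ.- (+ m) → x ≡ suc j + m
  to₂ e = sym (-ᶻ-≡⁻ {suc j} {x} {0} {m} (trans e (sym (ℤₚ.+-identityˡ _))))
  from₂ : x ≡ suc j + m → v ≡ ℤ.- (+ m)
  from₂ e = trans (-ᶻ-≡ {suc j} {x} {0} {m} (sym e)) (ℤₚ.+-identityˡ _)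
  first : (if v == (ℤ.- (+ m) ℤ.- + 1) then [ E ] else if v == (ℤ.- (+ m)) then [ N ] else [])
    ≡ guard (x ≟ suc j + suc m) E ++ guard (x ≟ suc j + m) N
  first = if-guard (v ℤ.≟ _) (v ℤ.≟ _) (x ≟ suc j + suc m) (x ≟ suc j + m) to₁ from₁ to₂ from₂
    (λ e e′ → 1+n≢n (sym (+-cancelˡ-≡ (suc j) m (suc m) (trans (sym (to₂ e′)) (to₁ e)))))

drawR : ℤ → ℤ → List Step
drawR i v = if v == (i ℤ.+ + 1) then [ E ] else if v == i then [ N ] else []

-- Serves to identify the local loop of `passR` from its two defining equations.
fold-concatMap : (h : A → List B) (f : List A → List B) → f [] ≡ [] → (∀ v a → f (v ∷ a) ≡ h v ++ f a) →
  ∀ a → f a ≡ concatMap h a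
fold-concatMap h f f[] f∷ []      = f[]
fold-concatMap h f f[] f∷ (v ∷ a) = trans (f∷ v a) (cong (h v ++_) (fold-concatMap h f f[] f∷ a))

-- The loop of passR is local to its where clause; unification recovers it as the solution of
-- drawAll once reverse a has been generalised to a variable.
mutual
  drawAll : ℤ → List ℤ → List ℤ → List Step
  drawAll = _

  passR-drawAll : ∀ i a → passR i a ≡ drawAll i a (reverse a)
  passR-drawAll i a with reverse a
  ... | b = refl

passR-concatMap : ∀ i a → passR i a ≡ concatMap (drawR i) (reverse a)
passR-concatMap i a = trans (passR-drawAll i a)
  (fold-concatMap (drawR i) (drawAll i a) refl (λ _ _ → refl) (reverse a))

drawR-guard : ∀ m x j → drawR (+ m) (+ suc j ℤ.- + x) ≡ guard (suc j ≟ x + suc m) E ++ guard (suc j ≟ x + m) N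
drawR-guard m x j = if-guard (v ℤ.≟ _) (v ℤ.≟ _) (suc j ≟ x + suc m) (suc j ≟ x + m)
    (to₁ ∘ flip trans (cong +_ (+-comm m 1))) (flip trans (cong +_ (+-comm 1 m)) ∘ from₁) to₁ from₁
    (λ e e′ → 1+n≢n (trans (sym (+-comm m 1)) (sym (ℤₚ.+-injective (trans (sym e′) e)))))
  where
  v = + suc j ℤ.- + x
  to₁ : ∀ {m} → v ≡ + m → suc j ≡ x + m
  to₁ {m} e = trans (sym (+-identityʳ _)) (trans (-ᶻ-≡⁻ {suc j} {x} {m} {0} (trans e (sym (ℤₚ.+-identityʳ _)))) (+-comm m x))
  from₁ : ∀ {m} → suc j ≡ x + m → v ≡ + m
  from₁ {m} e = trans (-ᶻ-≡ {suc j} {x} {m} {0} (trans (+-identityʳ _) (trans e (+-comm x m)))) (ℤₚ.+-identityʳ _)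

reverse-guard : {P : Set} (d : Dec P) {a : A} → reverse (guard d a) ≡ guard d a
reverse-guard (yes _) = refl
reverse-guard (no _)  = refl

passR-wordR : ∀ m x j p → passR (+ m) (areaFrom x j p) ≡ reverse (wordR m x j p)
passR-wordR m x j p = trans (passR-concatMap (+ m) (areaFrom x j p)) (go x j p)
  where
  open ≡-Reasoning
  D = drawR (+ m)
  go : ∀ x j p → concatMap D (reverse (areaFrom x j p)) ≡ reverse (wordR m x j p)
  go x j []      = refl
  go x j (E ∷ p) = go (suc x) j p
  go x j (N ∷ p) = begin
    concatMap D (reverse (v ∷ a))        ≡⟨ cong (concatMap D) (unfold-reverse v a) ⟩
    concatMap D (reverse a ++ [ v ])     ≡⟨ concatMap-++ D (reverse a) [ v ] ⟩
    concatMap D (reverse a) ++ D v ++ [] ≡⟨ cong₂ _++_ (go x (suc j) p) (trans (++-identityʳ (D v)) (drawR-guard m x j)) ⟩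
    reverse r ++ gE ++ gN                ≡⟨ cong (reverse r ++_) swap ⟩
    reverse r ++ gN ++ gE
      ≡⟨ cong (reverse r ++_) (cong₂ _++_ (reverse-guard (suc j ≟ x + m)) (reverse-guard (suc j ≟ x + suc m))) ⟨
    reverse r ++ reverse gN ++ reverse gE ≡⟨ ++-assoc (reverse r) _ _ ⟨
    (reverse r ++ reverse gN) ++ reverse gE ≡⟨ cong (_++ reverse gE) (reverse-++ gN r) ⟨
    reverse (gN ++ r) ++ reverse gE      ≡⟨ reverse-++ gE (gN ++ r) ⟨
    reverse (gE ++ gN ++ r) ∎
    where
    v = + suc j ℤ.- + x
    a = areaFrom x (suc j) p
    r = wordR m x (suc j) p
    gE = guard (suc j ≟ x + suc m) E
    gN = guard (suc j ≟ x + m) N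
    -- At most one of the two tests holds, so their order is immaterial.
    swap : gE ++ gN ≡ gN ++ gE
    swap with suc j ≟ x + m
    ... | no _  = ++-identityʳ _
    ... | yes e rewrite guard-no (suc j ≟ x + suc m) {E} (λ e′ → 1+n≢n (+-cancelˡ-≡ x (suc m) m (trans (sym e′) e))) = refl

module _ (a : List ℤ) where

  levelBlock : ℕ → List Step
  levelBlock k = passR (+ k) a ++ tail-block (λ m → passL (+ m) a) k

  -- The second half of each level is joined to the first half of the next. The first half of level
  -- K is left over in front, and the r negative levels go into `rest`.
  levels : ∀ K r (f : ℕ → List Step) → (∀ k → f k ≡ level (+ K ℤ.- + k) a) →
    ∃ λ rest → concat (applyUpTo f (suc K + r)) ≡ passL (+ K) a ++ descending K levelBlock ++ rest
  levels zero r f f≡ = _ , trans (cong (_++ rest) (f≡ 0)) (trans (++-assoc (passL (+ 0) a) _ rest)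
      (cong (λ t → passL (+ 0) a ++ t ++ rest) (sym (++-identityʳ _))))
    where rest = concat (applyUpTo (f ∘ suc) r)
  levels (suc K) r f f≡ with levels K r (f ∘ suc) (λ k → trans (f≡ (suc k))
      (cong (λ i → level i a) (-ᶻ-≡ {suc K} {suc k} {K} {k} (sym (+-suc K k)))))
  ... | rest , eq = rest , (begin
    f 0 ++ concat (applyUpTo (f ∘ suc) (suc K + r))
      ≡⟨ cong₂ _++_ (trans (f≡ 0) (cong (λ i → level i a) (ℤₚ.+-identityʳ (+ suc K)))) eq ⟩
    (l′ ++ r′) ++ l ++ c ++ rest   ≡⟨ ++-assoc l′ r′ _ ⟩
    l′ ++ r′ ++ l ++ c ++ rest     ≡⟨ cong (l′ ++_) (++-assoc r′ l _) ⟨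
    l′ ++ (r′ ++ l) ++ c ++ rest   ≡⟨ cong (l′ ++_) (++-assoc (r′ ++ l) c rest) ⟨
    l′ ++ ((r′ ++ l) ++ c) ++ rest ∎)
    where
    open ≡-Reasoning
    l′ = passL (+ suc K) a
    r′ = passR (+ suc K) a
    l = passL (+ K) a
    c = descending K levelBlock

-- The last column x + `numE p` is too small for the rest of the path to reach the diagonal x - y =
-- m + 1.
wordL-[] : ∀ m x y p → x + numE p ≤ y + m → wordL m x y p ≡ []
wordL-[] m x y []      h = refl
wordL-[] m x y (N ∷ p) h = cong₂ _++_ (guard-no (x ≟ suc y + suc m) (<⇒≢ (≤-trans x< (+-monoʳ-≤ (suc y) (n≤1+n m)))))
  (cong₂ _++_ (guard-no (x ≟ suc y + m) (<⇒≢ x<)) (wordL-[] m x (suc y) p (≤-trans h (n≤1+n _))))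
  where
  x< : x < suc y + m
  x< = s≤s (m+n≤o⇒m≤o x h)
wordL-[] m x y (E ∷ p) h = wordL-[] m (suc x) y p (≤-trans (≤-reflexive (sym (+-suc x _))) h)

wordR-[] : ∀ m x y p → y + numN p < x + m → wordR m x y p ≡ []
wordR-[] m x y []      h = refl
wordR-[] m x y (N ∷ p) h = cong₂ _++_ (guard-no (suc y ≟ x + suc m) (<⇒≢ (≤-trans y< (+-monoʳ-≤ x (n≤1+n m)))))
  (cong₂ _++_ (guard-no (suc y ≟ x + m) (<⇒≢ y<)) (wordR-[] m x (suc y) p h′))
  where
  h′ : suc y + numN p < x + m
  h′ = ≤-trans (≤-reflexive (cong suc (sym (+-suc y _)))) h
  y< : suc y < x + m
  y< = ≤-trans (s≤s (m≤m+n (suc y) _)) h′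
wordR-[] m x y (E ∷ p) h = wordR-[] m (suc x) y p (≤-trans h (n≤1+n _))

length-insertL : ∀ z a → length (insertL z a) ≡ suc (length a)
length-insertL z []      = refl
length-insertL z (u ∷ a) with label z ℤ.≤? label u
... | yes _ = refl
... | no  _ = cong suc (length-insertL z a)

length-sortL : ∀ a → length (sortL a) ≡ length a
length-sortL []      = refl
length-sortL (u ∷ a) = trans (length-insertL u (sortL a)) (cong suc (length-sortL a))

length-entries : ∀ {C : Set} (f : Step → Step → ℤ → C) n prev ℓ q →
  length (zipWith3 f q (dropLast (prev ∷ q)) (labelsFrom n ℓ q)) ≡ length q
length-entries f n prev ℓ []      = refl
length-entries f n prev ℓ (s ∷ q) = cong suc (length-entries f n s (ℓ ℤ.+ δ n s) q)

length-steps : ∀ p → length p ≡ numN p + numE p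
length-steps []      = refl
length-steps (N ∷ p) = cong suc (length-steps p)
length-steps (E ∷ p) = trans (cong suc (length-steps p)) (sym (+-suc _ _))

length-sw : ∀ n π → length (sw n π) ≡ length π
length-sw n π = trans (length-map step (sortL (sweepX n π))) (trans (length-sortL (sweepX n π)) (len π))
  where
  len : ∀ π → length (sweepX n π) ≡ length π
  len []      = refl
  len (s ∷ q) = cong suc (length-entries (entry n) n s (+ 0 ℤ.+ δ n s) q)

length-L : ∀ n π → IsL n π → length π ≡ n + n
length-L n π (eN , eE) = trans (length-steps π) (cong₂ _+_ eN eE)

take-++-length : (a b : List A) → take (length a) (a ++ b) ≡ a
take-++-length []      b = refl
take-++-length (u ∷ a) b = cong (u ∷_) (take-++-length a b)

-- The left-over pass at level n is empty, and the blocks already make up 2n steps, so `take`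
-- removes exactly `rest`.
sw≡ζC : ∀ n → 1 ≤ n → ∀ π → IsL n π → sw n π ≡ ζC n π
sw≡ζC n n≥1 π π∈L@(_ , eE) with levels (areaC π) n n (λ k → level (+ n ℤ.- + k) (areaC π)) (λ _ → refl)
... | rest , eq = sym (begin
  take (n + n) (concat (map f (upTo (suc (n + n)))))     ≡⟨ cong (λ ss → take (n + n) (concat ss)) (map-upTo f (suc (n + n))) ⟩
  take (n + n) (concat (applyUpTo f (suc (n + n))))      ≡⟨ cong (take (n + n)) eq ⟩
  take (n + n) (passL (+ n) (areaC π) ++ descending n (levelBlock (areaC π)) ++ rest)
    ≡⟨ cong₂ (λ l c → take (n + n) (l ++ c ++ rest)) (trans (passL-wordL n 0 0 π) (wordL-[] n 0 0 π (≤-reflexive eE))) blocks ⟩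
  take (n + n) (sw n π ++ rest)
    ≡⟨ cong (λ t → take t (sw n π ++ rest)) (trans (length-sw n π) (length-L n π π∈L)) ⟨
  take (length (sw n π)) (sw n π ++ rest)                ≡⟨ take-++-length (sw n π) rest ⟩
  sw n π ∎)
  where
  open ≡-Reasoning
  f : ℕ → List Step
  f k = level (+ n ℤ.- + k) (areaC π)
  blocks : descending n (levelBlock (areaC π)) ≡ sw n π
  blocks = trans (descending-cong n (λ k → cong₂ _++_ (passR-wordR k 0 0 π) (tail-block-cong (λ m → passL-wordL m 0 0 π) k)))
                 (sym (sw-blocks n n≥1 π π∈L))

-- Step counts of the passes, and why sw(π) lies in 𝓑_n.

numN-++ : ∀ a b → numN (a ++ b) ≡ numN a + numN b
numN-++ []      b = refl
numN-++ (N ∷ a) b = cong suc (numN-++ a b)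
numN-++ (E ∷ a) b = numN-++ a b

numE-++ : ∀ a b → numE (a ++ b) ≡ numE a + numE b
numE-++ []      b = refl
numE-++ (N ∷ a) b = numE-++ a b
numE-++ (E ∷ a) b = cong suc (numE-++ a b)

numN-reverse : ∀ a → numN (reverse a) ≡ numN a
numN-reverse []      = refl
numN-reverse (s ∷ a) = trans (cong numN (unfold-reverse s a)) (trans (numN-++ (reverse a) [ s ])
  (trans (+-comm _ (numN [ s ])) (trans (cong (λ t → numN [ s ] + t) (numN-reverse a)) (sym (numN-++ [ s ] a)))))

numE-reverse : ∀ a → numE (reverse a) ≡ numE a
numE-reverse []      = refl
numE-reverse (s ∷ a) = trans (cong numE (unfold-reverse s a)) (trans (numE-++ (reverse a) [ s ])
  (trans (+-comm _ (numE [ s ])) (trans (cong (λ t → numE [ s ] + t) (numE-reverse a)) (sym (numE-++ [ s ] a)))))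

numE≡numN-guard : {P Q R : Set} (d : Dec P) (e : Dec Q) (f : Dec R) {r r′ : List Step} → numE r ≡ numN r′ →
  numE (guard d E ++ guard e N ++ r) ≡ numN (guard f E ++ guard d N ++ r′)
numE≡numN-guard (yes _) (yes _) (yes _) h = cong suc h
numE≡numN-guard (yes _) (yes _) (no _)  h = cong suc h
numE≡numN-guard (yes _) (no _)  (yes _) h = cong suc h
numE≡numN-guard (yes _) (no _)  (no _)  h = cong suc h
numE≡numN-guard (no _)  (yes _) (yes _) h = h
numE≡numN-guard (no _)  (yes _) (no _)  h = h
numE≡numN-guard (no _)  (no _)  (yes _) h = h
numE≡numN-guard (no _)  (no _)  (no _)  h = h

numN-guard : {P Q : Set} (d : Dec P) (e : Dec Q) (r : List Step) →
  numN (guard d E ++ guard e N ++ r) ≡ numN (guard e N ++ r)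
numN-guard (yes _) e r = refl
numN-guard (no _)  e r = refl

-- An area entry m + 1 is drawn as E at level m and as N at level m + 1.
wordR-balance : ∀ m x y p → numE (wordR m x y p) ≡ numN (wordR (suc m) x y p)
wordR-balance m x y []      = refl
wordR-balance m x y (N ∷ p) =
  numE≡numN-guard (suc y ≟ x + suc m) (suc y ≟ x + m) (suc y ≟ x + suc (suc m)) (wordR-balance m x (suc y) p)
wordR-balance m x y (E ∷ p) = wordR-balance m (suc x) y p

wordL-balance : ∀ m x y p → numE (wordL m x y p) ≡ numN (wordL (suc m) x y p)
wordL-balance m x y []      = refl
wordL-balance m x y (N ∷ p) =
  numE≡numN-guard (x ≟ suc y + suc m) (x ≟ suc y + m) (x ≟ suc y + suc (suc m)) (wordL-balance m x (suc y) p)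
wordL-balance m x y (E ∷ p) = wordL-balance m (suc x) y p

-- An area entry 0 is drawn as N by both passes at level 0.
centre-balance : ∀ x y p → numN (wordL 0 x y p) ≡ numN (wordR 0 x y p)
centre-balance x y []      = refl
centre-balance x y (N ∷ p) = trans (numN-guard (x ≟ suc y + 1) (x ≟ suc y + 0) (wordL 0 x (suc y) p))
  (trans (trans (numN-++ (guard (x ≟ suc y + 0) N) _)
                (trans (cong₂ _+_ (cong numN same) (centre-balance x (suc y) p))
                       (sym (numN-++ (guard (suc y ≟ x + 0) N) _))))
         (sym (numN-guard (suc y ≟ x + 1) (suc y ≟ x + 0) (wordR 0 x (suc y) p))))
  where
  same : guard (x ≟ suc y + 0) N ≡ guard (suc y ≟ x + 0) N
  same = guard-cong (x ≟ suc y + 0) (suc y ≟ x + 0)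
    (λ e → trans (sym (+-identityʳ _)) (trans (sym e) (sym (+-identityʳ _))))
    (λ e → trans (sym (+-identityʳ _)) (trans (sym e) (sym (+-identityʳ _))))
centre-balance x y (E ∷ p) = centre-balance (suc x) y p

-- Structural form of the prefix condition in `IsB`, with h the surplus of N over E steps drawn
-- before.
Stays : ℕ → List Step → Set
Stays h       []      = ⊤
Stays h       (N ∷ p) = Stays (suc h) p
Stays zero    (E ∷ p) = ⊥
Stays (suc h) (E ∷ p) = Stays h p

-- If `a` has at most h E steps in all, their order does not matter; h′ is the surplus after `a`.
stays-++ : ∀ h h′ a b → numE a ≤ h → h′ + numE a ≡ h + numN a → Stays h′ b → Stays h (a ++ b)
stays-++ h h′ [] b _ eq st = subst (λ t → Stays t b) (trans (sym (+-identityʳ h′)) (trans eq (+-identityʳ h))) st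
stays-++ h h′ (N ∷ a) b E≤h eq st = stays-++ (suc h) h′ a b (m≤n⇒m≤1+n E≤h) (trans eq (+-suc h _)) st
stays-++ (suc h) h′ (E ∷ a) b E≤h eq st = stays-++ h h′ a b (≤-pred E≤h) (suc-injective (trans (sym (+-suc h′ _)) eq)) st

height : ∀ {h e k} → e ≤ h → h ∸ e + k + e ≡ h + k
height {h} {e} {k} e≤h = trans (+-assoc (h ∸ e) k e) (trans (cong (λ t → h ∸ e + t) (+-comm k e))
  (trans (sym (+-assoc (h ∸ e) e k)) (cong (_+ k) (m∸n+n≡m e≤h))))

stays⇒prefix : ∀ h p → Stays h p → ∀ k → numE (take k p) ≤ h + numN (take k p)
stays⇒prefix h p st zero = z≤n
stays⇒prefix h [] st (suc k) = z≤n
stays⇒prefix h (N ∷ p) st (suc k) = ≤-trans (stays⇒prefix (suc h) p st k) (≤-reflexive (sym (+-suc h _)))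
stays⇒prefix (suc h) (E ∷ p) st (suc k) = s≤s (stays⇒prefix h p st k)

prefix⇒stays : ∀ h p → (∀ k → numE (take k p) ≤ h + numN (take k p)) → Stays h p
prefix⇒stays h [] pre = tt
prefix⇒stays h (N ∷ p) pre = prefix⇒stays (suc h) p (λ k → ≤-trans (pre (suc k)) (≤-reflexive (+-suc h _)))
prefix⇒stays zero (E ∷ p) pre with () ← pre 1
prefix⇒stays (suc h) (E ∷ p) pre = prefix⇒stays h p (λ k → ≤-pred (pre (suc k)))

module _ (π : List Step) where

  private
    r l : ℕ → List Step
    r m = wordR m 0 0 π
    l m = wordL m 0 0 π

  numN-block : ∀ k → numN (block π (suc k)) ≡ numN (r (suc k)) + numN (l k)
  numN-block k = trans (numN-++ (reverse (r (suc k))) (l k)) (cong (_+ numN (l k)) (numN-reverse (r (suc k))))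

  numE-block : ∀ k → numE (block π (suc k)) ≡ numE (r (suc k)) + numE (l k)
  numE-block k = trans (numE-++ (reverse (r (suc k))) (l k)) (cong (_+ numE (l k)) (numE-reverse (r (suc k))))

  numE-block₀ : numE (block π 0) ≡ numE (r 0)
  numE-block₀ = trans (cong numE (++-identityʳ (reverse (r 0)))) (numE-reverse (r 0))

  numN-block₀ : numN (block π 0) ≡ numN (r 0)
  numN-block₀ = trans (cong numN (++-identityʳ (reverse (r 0)))) (numN-reverse (r 0))

  -- Besides the N partners of the E steps in block 0, block 1 contains the second drawing of the
  -- area entries 0.
  block-balance₀ : numN (block π 1) ≡ numE (block π 0) + numN (r 0)
  block-balance₀ = trans (numN-block 0) (cong₂ _+_ (trans (sym (wordR-balance 0 0 0 π)) (sym numE-block₀)) (centre-balance 0 0 π))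

  block-balance : ∀ k → numN (block π (suc (suc k))) ≡ numE (block π (suc k))
  block-balance k = trans (numN-block (suc k))
    (trans (cong₂ _+_ (sym (wordR-balance (suc k) 0 0 π)) (sym (wordL-balance k 0 0 π))) (sym (numE-block k)))

  numE≤numN : ∀ k → numE (block π k) ≤ numN (block π (suc k))
  numE≤numN zero    = ≤-trans (m≤m+n _ _) (≤-reflexive (sym block-balance₀))
  numE≤numN (suc k) = ≤-reflexive (sym (block-balance k))

  -- The N steps of each block alone suffice for the E steps of the next one.
  stays-descending : ∀ K h → numE (block π K) ≤ h → Stays h (descending K (block π))
  stays-descending zero h E≤h = subst (Stays h) (++-identityʳ b)
      (stays-++ h (h ∸ numE b + numN b) b [] E≤h (height E≤h) tt)
    where b = block π 0
  stays-descending (suc K) h E≤h = stays-++ h (h ∸ numE b + numN b) b (descending K (block π)) E≤h (height E≤h)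
      (stays-descending K _ (≤-trans (numE≤numN K) (m≤n+m _ _)))
    where b = block π (suc K)

  -- For a path in 𝓛_{n,n} block n contains no E step, so suc K = n gives the final height of sw(π).
  descending-excess : ∀ K → numN (descending (suc K) (block π)) + numE (block π (suc K))
    ≡ numE (descending (suc K) (block π)) + (numN (r 0) + numN (r 0))
  descending-excess zero
    rewrite numN-++ (block π 1) (block π 0) | numE-++ (block π 1) (block π 0) | block-balance₀ | numN-block₀ =
    eq (numE (block π 0)) (numN (r 0)) (numE (block π 1))
    where
    eq : ∀ e l f → e + l + l + f ≡ f + e + (l + l)
    eq = solve-∀
  descending-excess (suc K)
    rewrite numN-++ (block π (suc (suc K))) (descending (suc K) (block π))
          | numE-++ (block π (suc (suc K))) (descending (suc K) (block π))
          | block-balance K =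
    trans (eq (numE (block π (suc K))) (numN (descending (suc K) (block π))) f)
      (trans (cong (λ t → f + t) (descending-excess K)) (sym (+-assoc f _ _)))
    where
    f = numE (block π (suc (suc K)))
    eq : ∀ e c f → e + c + f ≡ f + (c + e)
    eq = solve-∀

-- By balance, an E here would be an N one level higher, where the words of a path in 𝓛 are empty.
numE-top-block : ∀ n π → IsL (suc n) π → numE (block π (suc n)) ≡ 0
numE-top-block n π (eN , eE) = trans (numE-block π n) (cong₂ _+_
  (trans (wordR-balance (suc n) 0 0 π) (cong numN (wordR-[] (suc (suc n)) 0 0 π (s≤s (≤-reflexive eN)))))
  (trans (wordL-balance n 0 0 π) (cong numN (wordL-[] (suc n) 0 0 π (≤-reflexive eE)))))

sw∈B : ∀ n → 1 ≤ n → ∀ π → IsL n π → IsB n (sw n π)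
sw∈B n@(suc n′) n≥1 π π∈L = trans (length-sw n π) (length-L n π π∈L) ,
  stays⇒prefix 0 (sw n π) (subst (Stays 0) (sym (sw-blocks n n≥1 π π∈L))
    (stays-descending π n 0 (≤-reflexive (numE-top-block n′ π π∈L))))

-- Cutting the reversed word into passes.

-- In the reversed word every pass after the first is empty or starts with N, which makes the cuts
-- recoverable.
NHead NHead⁺ : List Step → Set
NHead []      = ⊤
NHead (N ∷ _) = ⊤
NHead (E ∷ _) = ⊥

NHead⁺ []      = ⊥
NHead⁺ (N ∷ _) = ⊤
NHead⁺ (E ∷ _) = ⊥

nHead-++ : ∀ a b → NHead a → NHead b → NHead (a ++ b)
nHead-++ []      b _ h = h
nHead-++ (N ∷ a) b _ _ = tt

nHead⁺-++ : ∀ a b → NHead⁺ a → NHead⁺ (a ++ b)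
nHead⁺-++ (N ∷ a) b _ = tt

nHead⁺-∷ʳ : ∀ a → NHead a → NHead⁺ (a ++ [ N ])
nHead⁺-∷ʳ []      _ = tt
nHead⁺-∷ʳ (N ∷ a) _ = tt

nHead⁺⇒nHead : ∀ a → NHead⁺ a → NHead a
nHead⁺⇒nHead (N ∷ a) _ = tt

-- From strictly below the diagonal, the path must enter it by an N step before it can leave it
-- upwards.
wordR-nHead : ∀ m x y p → y < x + m → NHead (wordR m x y p)
wordR-nHead m x y []      h = tt
wordR-nHead m x y (E ∷ p) h = wordR-nHead m (suc x) y p (≤-trans h (n≤1+n _))
wordR-nHead m x y (N ∷ p) h
  rewrite guard-no (suc y ≟ x + suc m) {E} (<⇒≢ (≤-trans (s≤s h) (≤-reflexive (sym (+-suc x m)))))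
  with suc y ≟ x + m
... | yes _ = tt
... | no ≢  = wordR-nHead m x (suc y) p (≤∧≢⇒< h ≢)

reverse-wordL-N : ∀ m x y p → reverse (wordL m x y (N ∷ p)) ≡
  reverse (wordL m x (suc y) p) ++ guard (x ≟ suc y + m) N ++ guard (x ≟ suc y + suc m) E
reverse-wordL-N m x y p = begin
  reverse (gE ++ gN ++ r)                 ≡⟨ reverse-++ gE (gN ++ r) ⟩
  reverse (gN ++ r) ++ reverse gE         ≡⟨ cong (_++ reverse gE) (reverse-++ gN r) ⟩
  (reverse r ++ reverse gN) ++ reverse gE ≡⟨ ++-assoc (reverse r) _ _ ⟩
  reverse r ++ reverse gN ++ reverse gE
    ≡⟨ cong (reverse r ++_) (cong₂ _++_ (reverse-guard (x ≟ suc y + m)) (reverse-guard (x ≟ suc y + suc m))) ⟩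
  reverse r ++ gN ++ gE ∎
  where
  open ≡-Reasoning
  r = wordL m x (suc y) p
  gE = guard (x ≟ suc y + suc m) E
  gN = guard (x ≟ suc y + m) N

module _ (n : ℕ) where

  -- The path ends on x = y, so after entering the diagonal x - y = m + 1 from the right it leaves
  -- it again by an N step, and the last letter is N. From a point on or right of that diagonal,
  -- such a step is still to come.
  wordL-nHead : ∀ m x y p → Ends n x y p →
    (x ≤ y + m → NHead (reverse (wordL m x y p))) × (y + m < x → NHead⁺ (reverse (wordL m x y p)))
  wordL-nHead m x y [] e with refl , refl ← ends-[] n e = (λ _ → tt) , λ h → contradiction h (≤⇒≯ (m≤m+n n m))
  wordL-nHead m x y (E ∷ p) e with wordL-nHead m (suc x) y p (ends-step n E x y p e)
  ... | low , high = (λ h → weaken (m≤n⇒m<n∨m≡n h)) , λ h → high (≤-trans h (n≤1+n x))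
    where
    weaken : x < y + m ⊎ x ≡ y + m → NHead (reverse (wordL m (suc x) y p))
    weaken (inj₁ h)    = low h
    weaken (inj₂ refl) = nHead⁺⇒nHead (reverse (wordL m (suc x) y p)) (high ≤-refl)
  wordL-nHead m x y (N ∷ p) e with wordL-nHead m x (suc y) p (ends-step n N x y p e)
  ... | low , high rewrite reverse-wordL-N m x y p = lower , λ h → higher (m≤n⇒m<n∨m≡n h)
    where
    r = reverse (wordL m x (suc y) p)
    tl = guard (x ≟ suc y + m) N ++ guard (x ≟ suc y + suc m) E
    lower : x ≤ y + m → NHead (r ++ tl)
    lower h rewrite guard-no (x ≟ suc y + m) {N} (<⇒≢ (s≤s h))
      | guard-no (x ≟ suc y + suc m) {E} (<⇒≢ (s≤s (≤-trans h (+-monoʳ-≤ y (n≤1+n m))))) | ++-identityʳ r = low (m≤n⇒m≤1+n h)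
    higher : suc (y + m) < x ⊎ suc (y + m) ≡ x → NHead⁺ (r ++ tl)
    higher (inj₁ h)    = nHead⁺-++ r tl (high h)
    higher (inj₂ refl) rewrite guard-yes (suc (y + m) ≟ suc y + m) {N} refl
      | guard-no (suc (y + m) ≟ suc y + suc m) {E} (<⇒≢ (s≤s (≤-reflexive (sym (+-suc y m))))) = nHead⁺-∷ʳ r (low ≤-refl)

-- As the remainder is empty or starts with N, the cut is the longest prefix with the given number
-- of N steps.
peel : ∀ a a′ b b′ → NHead b → NHead b′ → numN a ≡ numN a′ → a ++ b ≡ a′ ++ b′ → a ≡ a′ × b ≡ b′
peel []      []       b b′ h h′ c e = refl , e
peel []      (E ∷ a′) b b′ h h′ c refl = ⊥-elim h
peel (E ∷ a) []       b b′ h h′ c refl = ⊥-elim h′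
peel (s ∷ a) (t ∷ a′) b b′ h h′ c e with refl , e′ ← ∷-injective e with peel a a′ b b′ h h′ (cancel s c) e′
  where
  cancel : ∀ s → numN (s ∷ a) ≡ numN (s ∷ a′) → numN a ≡ numN a′
  cancel N c = suc-injective c
  cancel E c = c
... | refl , q = refl , q

reversedBlocks : ℕ → List Step → List Step
reversedBlocks zero    π = wordR 0 0 0 π
reversedBlocks (suc K) π = reversedBlocks K π ++ reverse (wordL K 0 0 π) ++ wordR (suc K) 0 0 π

reverse-descending : ∀ K π → reverse (descending K (block π)) ≡ reversedBlocks K π
reverse-descending zero    π = trans (cong reverse (++-identityʳ (reverse (wordR 0 0 0 π)))) (reverse-involutive _)
reverse-descending (suc K) π = trans (reverse-++ (block π (suc K)) (descending K (block π)))
  (cong₂ _++_ (reverse-descending K π)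
  (trans (reverse-++ (reverse (wordR (suc K) 0 0 π)) (wordL K 0 0 π)) (cong (reverse (wordL K 0 0 π) ++_) (reverse-involutive _))))

module _ (n : ℕ) {π ρ : List Step} (π∈L : IsL n π) (ρ∈L : IsL n ρ)
         (centre : numN (wordR 0 0 0 π) ≡ numN (wordR 0 0 0 ρ)) where

  -- The number of N steps to peel off is known in advance: by balance it is the number of E steps
  -- in the pass on the same side one level lower, already recovered, and at level 0 it comes from
  -- `centre`.
  decode : ∀ K u u′ → NHead u → NHead u′ → reversedBlocks K π ++ u ≡ reversedBlocks K ρ ++ u′ →
    u ≡ u′ × (∀ m → m ≤ K → wordR m 0 0 π ≡ wordR m 0 0 ρ) × (∀ m → m < K → wordL m 0 0 π ≡ wordL m 0 0 ρ)
  decode zero u u′ h h′ e with peel (wordR 0 0 0 π) (wordR 0 0 0 ρ) u u′ h h′ centre e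
  ... | r , q = q , (λ { _ z≤n → r }) , λ _ ()
  decode (suc K) u u′ h h′ e
    with decode K (l π ++ r π ++ u) (l ρ ++ r ρ ++ u′) (starts π π∈L u h) (starts ρ ρ∈L u′ h′)
           (trans (sym (assoc π u)) (trans e (assoc ρ u′)))
    where
    l r : List Step → List Step
    l σ = reverse (wordL K 0 0 σ)
    r σ = wordR (suc K) 0 0 σ
    starts : ∀ σ → IsL n σ → ∀ u → NHead u → NHead (l σ ++ r σ ++ u)
    starts σ (eN , eE) u h = nHead-++ (l σ) _ (proj₁ (wordL-nHead n K 0 0 σ (eE , eN)) z≤n)
      (nHead-++ (r σ) u (wordR-nHead (suc K) 0 0 σ (s≤s z≤n)) h)
    assoc : ∀ σ u → (reversedBlocks K σ ++ l σ ++ r σ) ++ u ≡ reversedBlocks K σ ++ l σ ++ r σ ++ u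
    assoc σ u = trans (++-assoc (reversedBlocks K σ) _ u) (cong (reversedBlocks K σ ++_) (++-assoc (l σ) (r σ) u))
  ... | q , rs , ls
    with peel (reverse (wordL K 0 0 π)) (reverse (wordL K 0 0 ρ)) _ _ (rest π u h) (rest ρ u′ h′)
           (trans (numN-reverse (wordL K 0 0 π)) (trans (count K rs ls) (sym (numN-reverse (wordL K 0 0 ρ))))) q
    where
    rest : ∀ σ u → NHead u → NHead (wordR (suc K) 0 0 σ ++ u)
    rest σ u = nHead-++ (wordR (suc K) 0 0 σ) u (wordR-nHead (suc K) 0 0 σ (s≤s z≤n))
    count : ∀ K → (∀ m → m ≤ K → wordR m 0 0 π ≡ wordR m 0 0 ρ) → (∀ m → m < K → wordL m 0 0 π ≡ wordL m 0 0 ρ) →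
      numN (wordL K 0 0 π) ≡ numN (wordL K 0 0 ρ)
    count zero    _ _  = trans (centre-balance 0 0 π) (trans centre (sym (centre-balance 0 0 ρ)))
    count (suc K) _ ls = trans (sym (wordL-balance K 0 0 π)) (trans (cong numE (ls K ≤-refl)) (wordL-balance K 0 0 ρ))
  ... | lK , q′
    with peel (wordR (suc K) 0 0 π) (wordR (suc K) 0 0 ρ) u u′ h h′
           (trans (sym (wordR-balance K 0 0 π)) (trans (cong numE (rs K ≤-refl)) (wordR-balance K 0 0 ρ))) q′
  ... | rK , q″ = q″ , (λ m m≤ → extend-r m (m≤n⇒m<n∨m≡n m≤)) , λ m m< → extend-l m (m≤n⇒m<n∨m≡n (≤-pred m<))
    where
    extend-r : ∀ m → m < suc K ⊎ m ≡ suc K → wordR m 0 0 π ≡ wordR m 0 0 ρ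
    extend-r m (inj₁ m<) = rs m (≤-pred m<)
    extend-r m (inj₂ refl) = rK
    extend-l : ∀ m → m < K ⊎ m ≡ K → wordL m 0 0 π ≡ wordL m 0 0 ρ
    extend-l m (inj₁ m<) = ls m m<
    extend-l m (inj₂ refl) = reverse-injective lK

-- Rebuilding the path from its passes; injectivity.

flipStep : Step → Step
flipStep N = E
flipStep E = N

module _ (n : ℕ) where

  -- Flipping restores the N steps leaving the diagonal upwards, and turns each N step entering it
  -- from below into the E step by which the path last went below. The guards stand for a start
  -- below the diagonal and for the last descent, which has no return.
  wordR-outgoingR : ∀ m x y p → Ends n x y p →
    map flipStep (wordR m x y p) ++ guard (0 <? m) E ≡ guard (y <? x + m) E ++ outgoingR m x y p
  wordR-outgoingR m x y [] e with refl , refl ← ends-[] n e = trans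
    (guard-cong (0 <? m) (n <? n + m) (λ h → m<m+n n h)
      (λ h → +-cancelˡ-< n 0 m (≤-trans (s≤s (≤-reflexive (+-identityʳ n))) h)))
    (sym (++-identityʳ _))
  wordR-outgoingR m x y (E ∷ p) e = trans (wordR-outgoingR m (suc x) y p (ends-step n E x y p e))
      (trans (cong (_++ outgoingR m (suc x) y p) split) (++-assoc (guard (y <? x + m) E) _ _))
    where
    split : guard (y <? suc x + m) E ≡ guard (y <? x + m) E ++ guard (y ≟ x + m) E
    split with <-cmp y (x + m)
    ... | tri< a ≢ _ rewrite guard-yes (y <? x + m) {E} a | guard-no (y ≟ x + m) {E} ≢
           | guard-yes (y <? suc x + m) {E} (≤-trans a (n≤1+n _)) = refl
    ... | tri≈ ≮ eq _ rewrite guard-no (y <? x + m) {E} ≮ | guard-yes (y ≟ x + m) {E} eq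
           | guard-yes (y <? suc x + m) {E} (s≤s (≤-reflexive eq)) = refl
    ... | tri> ≮ ≢ c rewrite guard-no (y <? x + m) {E} ≮ | guard-no (y ≟ x + m) {E} ≢ | guard-no (y <? suc x + m) {E} (≤⇒≯ c) = refl
  wordR-outgoingR m x y (N ∷ p) e = begin
    map flipStep (gE ++ gN ++ r) ++ t
      ≡⟨ cong (_++ t) (trans (map-++ flipStep gE _) (cong₂ _++_ (map-guard flipStep (suc y ≟ x + suc m))
           (trans (map-++ flipStep gN r) (cong (_++ map flipStep r) (map-guard flipStep (suc y ≟ x + m)))))) ⟩
    (fE ++ fN ++ map flipStep r) ++ t  ≡⟨ trans (++-assoc fE _ t) (cong (fE ++_) (++-assoc fN _ t)) ⟩
    fE ++ fN ++ map flipStep r ++ t    ≡⟨ cong (λ z → fE ++ fN ++ z) (wordR-outgoingR m x (suc y) p (ends-step n N x y p e)) ⟩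
    fE ++ fN ++ guard (suc y <? x + m) E ++ o ≡⟨ turn ⟩
    guard (y <? x + m) E ++ guard (y ≟ x + m) N ++ o ∎
    where
    open ≡-Reasoning
    r = wordR m x (suc y) p
    o = outgoingR m x (suc y) p
    t = guard (0 <? m) E
    gE = guard (suc y ≟ x + suc m) E
    gN = guard (suc y ≟ x + m) N
    fE = guard (suc y ≟ x + suc m) N
    fN = guard (suc y ≟ x + m) E
    turn : fE ++ fN ++ guard (suc y <? x + m) E ++ o ≡ guard (y <? x + m) E ++ guard (y ≟ x + m) N ++ o
    turn rewrite guard-cong (suc y ≟ x + suc m) (y ≟ x + m) {N}
        (λ eq → suc-injective (trans eq (+-suc x m))) (λ eq → trans (cong suc eq) (sym (+-suc x m)))
      with <-cmp y (x + m)
    ... | tri≈ ≮ eq _ rewrite guard-yes (y ≟ x + m) {N} eq | guard-no (y <? x + m) {E} ≮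
           | guard-no (suc y ≟ x + m) {E} (λ eq′ → 1+n≢n (trans eq′ (sym eq)))
           | guard-no (suc y <? x + m) {E} (λ h → ≮ (<-trans (n<1+n y) h)) = refl
    ... | tri> ≮ ≢ c rewrite guard-no (y ≟ x + m) {N} ≢ | guard-no (y <? x + m) {E} ≮
           | guard-no (suc y ≟ x + m) {E} (λ eq → <⇒≢ (<-trans c (n<1+n y)) (sym eq))
           | guard-no (suc y <? x + m) {E} (λ h → ≮ (<-trans (n<1+n y) h)) = refl
    ... | tri< a ≢ _ rewrite guard-no (y ≟ x + m) {N} ≢ | guard-yes (y <? x + m) {E} a with m≤n⇒m<n∨m≡n a
    ...   | inj₁ h rewrite guard-yes (suc y <? x + m) {E} h | guard-no (suc y ≟ x + m) {E} (<⇒≢ h) = refl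
    ...   | inj₂ eq rewrite guard-no (suc y <? x + m) {E} (<-irrefl eq) | guard-yes (suc y ≟ x + m) {E} eq = refl

  wordR⇒outgoingR : ∀ m π ρ → IsL n π → IsL n ρ →
    wordR m 0 0 π ≡ wordR m 0 0 ρ → outgoingR m 0 0 π ≡ outgoingR m 0 0 ρ
  wordR⇒outgoingR m π ρ (πN , πE) (ρN , ρE) eq = ++-cancelˡ (guard (0 <? m) E) _ _
    (trans (sym (wordR-outgoingR m 0 0 π (πE , πN)))
      (trans (cong (λ w → map flipStep w ++ guard (0 <? m) E) eq) (wordR-outgoingR m 0 0 ρ (ρE , ρN))))

  wordL⇒outgoingL : ∀ m π ρ → IsL n π → IsL n ρ →
    wordL m 0 0 π ≡ wordL m 0 0 ρ → outgoingL m 0 0 π ≡ outgoingL m 0 0 ρ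
  wordL⇒outgoingL m π ρ (πN , πE) (ρN , ρE) eq = ++-cancelˡ (guard (suc m <? 0) E) _ _
    (trans (sym (wordL-outgoingL n m 0 0 π (πE , πN))) (trans eq (wordL-outgoingL n m 0 0 ρ (ρE , ρN))))

outgoingR-head : ∀ m x p → head (outgoingR m x (x + m) p) ≡ head p
outgoingR-head m x []      = refl
outgoingR-head m x (s ∷ p) rewrite guard-yes (x + m ≟ x + m) {s} refl = refl

outgoingL-head : ∀ m y p → head (outgoingL m (suc (y + m)) y p) ≡ head p
outgoingL-head m y []      = refl
outgoingL-head m y (s ∷ p) rewrite guard-yes (suc (y + m) ≟ suc (y + m)) {s} refl = refl

-- The current point lies on one of the diagonals, and the outgoing word of that diagonal begins
-- with the next step of the path.
outgoing-unique : ∀ p q x y → (∀ m → outgoingR m x y p ≡ outgoingR m x y q) →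
  (∀ m → outgoingL m x y p ≡ outgoingL m x y q) → p ≡ q
outgoing-unique p q x y o l = by-head p q o l (same-head (≤-<-connex x y) o l)
  where
  same-head : x ≤ y ⊎ y < x → (∀ m → outgoingR m x y p ≡ outgoingR m x y q) →
    (∀ m → outgoingL m x y p ≡ outgoingL m x y q) → head p ≡ head q
  same-head (inj₁ x≤y) o l with m , refl ← m≤n⇒∃[o]m+o≡n x≤y =
    trans (sym (outgoingR-head m x p)) (trans (cong head (o m)) (outgoingR-head m x q))
  same-head (inj₂ y<x) o l with m , refl ← m≤n⇒∃[o]m+o≡n y<x =
    trans (sym (outgoingL-head m y p)) (trans (cong head (l m)) (outgoingL-head m y q))
  by-head : ∀ p q → (∀ m → outgoingR m x y p ≡ outgoingR m x y q) →
    (∀ m → outgoingL m x y p ≡ outgoingL m x y q) → head p ≡ head q → p ≡ q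
  by-head []      []      o l _    = refl
  by-head (s ∷ p) (s ∷ q) o l refl = cong (s ∷_) (outgoing-unique p q (east s x) (north s y)
    (λ m → ++-cancelˡ (guard (y ≟ x + m) s) _ _ (o m))
    (λ m → ++-cancelˡ (guard (x ≟ suc (y + m)) s) _ _ (l m)))

double-injective : ∀ {a b} → a + a ≡ b + b → a ≡ b
double-injective {a} {b} e with <-cmp a b
... | tri< a<b _ _ = contradiction e (<⇒≢ (+-mono-< a<b a<b))
... | tri≈ _ eq _  = eq
... | tri> _ _ b<a = contradiction (sym e) (<⇒≢ (+-mono-< b<a b<a))

sw-excess : ∀ n → 1 ≤ n → ∀ π → IsL n π →
  numN (sw n π) ≡ numE (sw n π) + (numN (wordR 0 0 0 π) + numN (wordR 0 0 0 π))
sw-excess n@(suc n′) n≥1 π π∈L rewrite sw-blocks n n≥1 π π∈L = trans (sym (+-identityʳ _))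
  (trans (cong (λ t → numN (descending n (block π)) + t) (sym (numE-top-block n′ π π∈L))) (descending-excess π n′))

sw-injective : ∀ n → 1 ≤ n → ∀ π ρ → IsL n π → IsL n ρ → sw n π ≡ sw n ρ → π ≡ ρ
sw-injective n n≥1 π ρ π∈L ρ∈L e =
  outgoing-unique π ρ 0 0 (λ m → wordR⇒outgoingR n m π ρ π∈L ρ∈L (wordR-eq m))
    (λ m → wordL⇒outgoingL n m π ρ π∈L ρ∈L (wordL-eq m))
  where
  -- The surplus of N over E steps in the common image is twice this number.
  centre : numN (wordR 0 0 0 π) ≡ numN (wordR 0 0 0 ρ)
  centre = double-injective (+-cancelˡ-≡ (numE (sw n π)) _ _ (trans (sym (sw-excess n n≥1 π π∈L))
    (trans (cong numN e) (trans (sw-excess n n≥1 ρ ρ∈L)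
      (cong (λ w → numE w + (numN (wordR 0 0 0 ρ) + numN (wordR 0 0 0 ρ))) (sym e))))))
  reversedBlocks-eq : reversedBlocks n π ≡ reversedBlocks n ρ
  reversedBlocks-eq = trans (sym (reverse-descending n π)) (trans (cong reverse
    (trans (sym (sw-blocks n n≥1 π π∈L)) (trans e (sw-blocks n n≥1 ρ ρ∈L)))) (reverse-descending n ρ))
  decoded = decode n π∈L ρ∈L centre n [] [] tt tt (cong (_++ []) reversedBlocks-eq)
  wordR-eq : ∀ m → wordR m 0 0 π ≡ wordR m 0 0 ρ
  wordR-eq m with ≤-<-connex m n
  ... | inj₁ m≤n = proj₁ (proj₂ decoded) m m≤n
  ... | inj₂ n<m = trans (wordR-[] m 0 0 π (≤-trans (s≤s (≤-reflexive (proj₁ π∈L))) n<m))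
                     (sym (wordR-[] m 0 0 ρ (≤-trans (s≤s (≤-reflexive (proj₁ ρ∈L))) n<m)))
  wordL-eq : ∀ m → wordL m 0 0 π ≡ wordL m 0 0 ρ
  wordL-eq m with ≤-<-connex n m
  ... | inj₁ n≤m = trans (wordL-[] m 0 0 π (≤-trans (≤-reflexive (proj₂ π∈L)) n≤m))
                     (sym (wordL-[] m 0 0 ρ (≤-trans (≤-reflexive (proj₂ ρ∈L)) n≤m)))
  ... | inj₂ m<n = proj₂ (proj₂ decoded) m m<n

-- Lifting 𝓑_n back to 𝓛_{n,n}.

-- c is the height above the lowest diagonal reached so far; an E step that goes below it becomes N.
raise : ℕ → List Step → List Step
raise c       []      = []
raise c       (N ∷ p) = N ∷ raise (suc c) p
raise zero    (E ∷ p) = N ∷ raise zero p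
raise (suc c) (E ∷ p) = E ∷ raise c p

stays? : ∀ h p → Dec (Stays h p)
stays? h       []      = yes tt
stays? h       (N ∷ p) = stays? (suc h) p
stays? zero    (E ∷ p) = no (λ ())
stays? (suc h) (E ∷ p) = stays? h p

-- Started at height c, the path comes down to height 0; for `suc c` this means going below 0 when
-- started one lower.
Touches : ℕ → List Step → Set
Touches zero    β = ⊤
Touches (suc c) β = ¬ Stays c β

touches-E : ∀ c {j β} → j ≡ 0 ⊎ ¬ Stays c (E ∷ β) → j ≡ 0 ⊎ Touches c β
touches-E c       (inj₁ e) = inj₁ e
touches-E zero    (inj₂ _) = inj₂ tt
touches-E (suc c) (inj₂ t) = inj₂ t

-- Flips the first j last-passage N steps of β.  If c > 0, the path must first come down to the
-- previous minimum for any step to be flipped.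
unraise : ∀ β c j → Stays c β → j ≡ 0 ⊎ Touches c β → j + numE β ≤ c + numN β →
  ∃ λ p → raise c p ≡ β × numN p + j ≡ numN β × numE p ≡ numE β + j
unraise [] c       zero    st t bound = [] , refl , refl , refl
unraise [] (suc c) (suc j) st (inj₂ t) bound = contradiction tt t
unraise (E ∷ β) (suc c) j st t bound
  with p , r , eN , eE ← unraise β c j st (touches-E c t) (≤-pred (≤-trans (≤-reflexive (sym (+-suc j _))) bound))
  = E ∷ p , cong (E ∷_) r , eN , cong suc eE
unraise (N ∷ β) (suc c) j st t bound
  with p , r , eN , eE ← unraise β (suc (suc c)) j st t (≤-trans bound (≤-reflexive (+-suc (suc c) _)))
  = N ∷ p , cong (N ∷_) r , cong suc eN , eE
unraise (N ∷ β) zero zero st t bound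
  with p , r , eN , eE ← unraise β 1 0 st (inj₁ refl) bound
  = N ∷ p , cong (N ∷_) r , cong suc eN , eE
unraise (N ∷ β) zero (suc j) st t bound with stays? 0 β
-- From height 1, reached by this N step, `β` never returns to height 0: the step is a last passage
-- and is flipped.
... | yes st₀ with p , r , eN , eE ← unraise β 0 j st₀ (inj₂ tt) (≤-pred bound)
  = E ∷ p , cong (N ∷_) r , trans (+-suc (numN p) j) (cong suc eN) , trans (cong suc eE) (sym (+-suc _ j))
... | no ¬st₀ with p , r , eN , eE ← unraise β 1 (suc j) st (inj₂ ¬st₀) bound
  = N ∷ p , cong (N ∷_) r , cong suc eN , eE

-- A path of 𝓑_n with e steps E has e ≤ n, so flipping n - e of its N steps leaves n steps of each
-- kind.
unraise-B : ∀ n β → IsB n β → ∃ λ p → IsL n p × raise 0 p ≡ β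
unraise-B n β (len , pre) = finish (unraise β 0 (n ∸ e) (prefix⇒stays 0 β pre) (inj₂ tt)
  (≤-trans (≤-reflexive (m∸n+n≡m e≤n)) n≤N))
  where
  open ≡-Reasoning
  e = numE β
  total : numN β + e ≡ n + n
  total = trans (sym (length-steps β)) len
  E≤N : e ≤ numN β
  E≤N = subst (λ w → numE w ≤ numN w) (take-all (length β) β ≤-refl) (pre (length β))
  e≤n : e ≤ n
  e≤n with ≤-<-connex e n
  ... | inj₁ e≤n = e≤n
  ... | inj₂ n<e = contradiction (sym total) (<⇒≢ (+-mono-< (≤-trans n<e E≤N) n<e))
  n≤N : n ≤ numN β
  n≤N with ≤-<-connex n (numN β)
  ... | inj₁ n≤N = n≤N
  ... | inj₂ N<n = contradiction total (<⇒≢ (+-mono-< N<n (≤-trans (s≤s E≤N) N<n)))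
  finish : (∃ λ p → raise 0 p ≡ β × numN p + (n ∸ e) ≡ numN β × numE p ≡ e + (n ∸ e)) → ∃ λ p → IsL n p × raise 0 p ≡ β
  finish (p , r , eN , eE) = p , (+-cancelʳ-≡ n (numN p) n (begin
      numN p + n             ≡⟨ cong (λ t → numN p + t) (m∸n+n≡m e≤n) ⟨
      numN p + (n ∸ e + e)   ≡⟨ +-assoc (numN p) (n ∸ e) e ⟨
      numN p + (n ∸ e) + e   ≡⟨ cong (_+ e) eN ⟩
      numN β + e             ≡⟨ total ⟩
      n + n ∎)
    , trans eE (m+[n∸m]≡n e≤n)) , r

-- Surjectivity by counting.

code : ∀ k → List Step → Fin (2 ^ k)
code zero    p       = zero
-- A default for words that are too short; `code-injective` concerns words of length k only.
code (suc k) []      = combine {2} zero (code k [])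
code (suc k) (N ∷ p) = combine {2} zero (code k p)
code (suc k) (E ∷ p) = combine {2} (suc zero) (code k p)

code-injective : ∀ k p q → length p ≡ k → length q ≡ k → code k p ≡ code k q → p ≡ q
code-injective zero    []      []      _  _  _ = refl
code-injective (suc k) (N ∷ p) (N ∷ q) lp lq e =
  cong (N ∷_) (code-injective k p q (suc-injective lp) (suc-injective lq)
    (proj₂ (combine-injective {2} zero (code k p) zero (code k q) e)))
code-injective (suc k) (E ∷ p) (E ∷ q) lp lq e =
  cong (E ∷_) (code-injective k p q (suc-injective lp) (suc-injective lq)
    (proj₂ (combine-injective {2} (suc zero) (code k p) (suc zero) (code k q) e)))
code-injective (suc k) (N ∷ p) (E ∷ q) lp lq e with () ← proj₁ (combine-injective {2} zero (code k p) (suc zero) (code k q) e)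
code-injective (suc k) (E ∷ p) (N ∷ q) lp lq e with () ← proj₁ (combine-injective {2} (suc zero) (code k p) zero (code k q) e)

-- The orbit of s under h returns to s because h is injective on finitely many words.
module _ {S : Set} (word : S → List Step) (k : ℕ) (length-word : ∀ s → length (word s) ≡ k)
         (h : S → S) (h-injective : ∀ s t → word (h s) ≡ word (h t) → word s ≡ word t) where

  private
    orbit : ℕ → S → S
    orbit zero    s = s
    orbit (suc i) s = h (orbit i s)

    return : ∀ s i d → word (orbit i s) ≡ word (orbit (i + d) s) → word s ≡ word (orbit d s)
    return s zero    d e = e
    return s (suc i) d e = return s i d (h-injective _ _ e)

  injective⇒surjective : ∀ s → ∃ λ t → word s ≡ word (h t)
  injective⇒surjective s
    with i , j , i<j , e ← pigeonhole (n<1+n (2 ^ k)) (λ i → code k (word (orbit (toℕ i) s)))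
    -- As `i < j` unfolds to `suc i ≤ j`, the period is `suc d`, and `orbit d s` is the preimage.
    with d , i+d≡j ← m≤n⇒∃[o]m+o≡n i<j
    = orbit d s , return s (toℕ i) (suc d) (trans
        (code-injective k _ _ (length-word _) (length-word _) e)
        (cong (λ m → word (orbit m s)) (trans (sym i+d≡j) (sym (+-suc (toℕ i) d)))))

-- The self-map `h` of 𝓛_{n,n} is sw followed by a chosen preimage under `raise 0`. It inherits
-- injectivity from sw, and whatever `h` sends to the lift of β is sent to β by sw.
sw-surjective : ∀ n → 1 ≤ n → ∀ β → IsB n β → ∃ λ π → IsL n π × sw n π ≡ β
sw-surjective n n≥1 β β∈B = preimage
  where
  S : Set
  S = ∃ (IsL n)
  lift : ∀ β → IsB n β → S
  lift β β∈B = proj₁ (unraise-B n β β∈B) , proj₁ (proj₂ (unraise-B n β β∈B))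
  raise-step′ : ∀ β β∈B → raise 0 (proj₁ (lift β β∈B)) ≡ β
  raise-step′ β β∈B = proj₂ (proj₂ (unraise-B n β β∈B))
  h : S → S
  h (π , π∈L) = lift (sw n π) (sw∈B n n≥1 π π∈L)
  raise-h : ∀ s → raise 0 (proj₁ (h s)) ≡ sw n (proj₁ s)
  raise-h (π , π∈L) = raise-step′ (sw n π) (sw∈B n n≥1 π π∈L)
  preimage : ∃ λ π → IsL n π × sw n π ≡ β
  preimage = finish (injective⇒surjective proj₁ (n + n) (λ s → length-L n (proj₁ s) (proj₂ s)) h h-injective (lift β β∈B))
    where
    h-injective : ∀ s t → proj₁ (h s) ≡ proj₁ (h t) → proj₁ s ≡ proj₁ t
    h-injective s t eq = sw-injective n n≥1 (proj₁ s) (proj₁ t) (proj₂ s) (proj₂ t)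
        (trans (sym (raise-h s)) (trans (cong (raise 0) eq) (raise-h t)))
    finish : (∃ λ t → proj₁ (lift β β∈B) ≡ proj₁ (h t)) → ∃ λ π → IsL n π × sw n π ≡ β
    finish (t , e) = proj₁ t , proj₂ t , trans (sym (raise-h t)) (trans (cong (raise 0) (sym e)) (raise-step′ β β∈B))

theorem4p4 : (n : ℕ) → n ≥ 1 →
    ((π : List Step) → IsL n π → sw n π ≡ ζC n π)
    × ((π : List Step) → IsL n π → IsB n (sw n π))
    × ((π ρ : List Step) → IsL n π → IsL n ρ → sw n π ≡ sw n ρ → π ≡ ρ)
    × ((β : List Step) → IsB n β → ∃ λ π → IsL n π × sw n π ≡ β)
theorem4p4 n n≥1 = sw≡ζC n n≥1 , sw∈B n n≥1 , sw-injective n n≥1 , sw-surjective n n≥1
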